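{- Let $T$ be a set of transpositions in the symmetric group $S_m$ such that $G_T\cong C_m$, the cycle graph with $m$ vertices. Then $\mathrm{Cay}(S_m,T)$ is integral if and only if $m=3$ or $m=4$.
   Context: $S_m$ is the symmetric group on $\{1,\dots,m\}$. For a group $G$ and an inverse-closed subset $S\subseteq G$ not containing the identity, $\mathrm{Cay}(G,S)$ is the graph with vertex set $G$ in which $g_1,g_2$ are adjacent if and only if $g_1g_2^{ -1}\in S$. For a set $T$ of transpositions in $S_m$, $G_T$ is the graph with vertex set $\{1,\dots,m\}$ in which $i,j$ are adjacent if and only if $(i,j)\in T$. A finite simple graph is integral if all eigenvalues of its adjacency matrix are integers. Graphs are simple, so the cycle $C_m$ has $m\ge 3$. -}

module Defs where

open import Algebra.Bundles using (Group)
import Algebra.Properties.Group as GroupProperties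
open import Data.Bool.Base using (if_then_else_)
open import Data.Fin.Base
  using (Fin; zero; suc; toℕ; combine; remQuot; punchIn)
open import Data.Fin.Permutation as Perm
  using (Permutation′; _⟨$⟩ʳ_; _⟨$⟩ˡ_; _∘ₚ_; flip; transpose; insert; remove;
         insert-remove; remove-insert; punchIn-permute)
open import Data.Fin.Properties as Fin
  using (punchIn-injective; combine-remQuot; remQuot-combine)
open import Data.Integer.Base as ℤ using (ℤ)
open import Data.Nat.Base as ℕ using (ℕ; zero; suc; _!; s≤s)
import Data.Nat.Properties as ℕ
open import Data.Product.Base using (Σ; ∃; ∃₂; _×_; _,_; proj₁; proj₂)
open import Data.Rational.Base as ℚ using (ℚ; 0ℚ; 1ℚ; ∣_∣; Positive)
import Data.Rational.Properties as ℚ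
open import Data.Rational.Solver using (module +-*-Solver)
open import Data.Sum.Base using (_⊎_; inj₁; inj₂; swap)
open import Data.Vec.Functional using (Vector; foldr)
open import Function.Base using (_∘_)
open import Function.Bundles using (Inverse; _⇔_)
import Function.Construct.Identity as Identity
open import Level using (0ℓ)
open import Relation.Binary.Bundles using (Setoid)
open import Relation.Binary.Core using (Rel)
open import Relation.Binary.Definitions
  using (Symmetric; Decidable; _Respects_; _Respects₂_)
open import Relation.Binary.PropositionalEquality
  using (_≡_; _≢_; refl; sym; trans; cong; cong₂; subst; setoid)
open import Relation.Nullary using (¬_; does; yes; no)
open import Relation.Nullary.Decidable
  using (_×-dec_; _⊎-dec_; dec-no; dec-true)
open import Relation.Unary using (Pred)
import Relation.Unary as Unary

------------------------------------------------------------------------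
-- Real numbers: Cauchy sequences of rationals, identified when their
-- difference tends to 0.

Cauchy : (ℕ → ℚ) → Set
Cauchy x = ∀ ε → 0ℚ ℚ.< ε →
  ∃ λ N → ∀ m n → N ℕ.≤ m → N ℕ.≤ n → ∣ x m ℚ.- x n ∣ ℚ.< ε

record ℝ : Set where
  constructor mkℝ
  field
    seq    : ℕ → ℚ
    cauchy : Cauchy seq

open ℝ public

infix 4 _≈ᵣ_
infixl 6 _+ᵣ_
infixl 7 _*ᵣ_

_≈ᵣ_ : Rel ℝ 0ℓ
x ≈ᵣ y = ∀ ε → 0ℚ ℚ.< ε →
  ∃ λ N → ∀ n → N ℕ.≤ n → ∣ seq x n ℚ.- seq y n ∣ ℚ.< ε

fromℚ : ℚ → ℝ
fromℚ q = mkℝ (λ _ → q) λ ε 0<ε →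
  0 , λ _ _ _ _ → subst (ℚ._< ε) (sym (cong ∣_∣ (ℚ.+-inverseʳ q))) 0<ε

fromℤ : ℤ → ℝ
fromℤ z = fromℚ (z ℚ./ 1)

0ᵣ 1ᵣ : ℝ
0ᵣ = fromℚ 0ℚ
1ᵣ = fromℚ 1ℚ

module CauchyProperties where
  module ℚ-Arith where
    open +-*-Solver

    +-diff : ∀ a b c d → (a ℚ.+ b) ℚ.- (c ℚ.+ d) ≡ (a ℚ.- c) ℚ.+ (b ℚ.- d)
    +-diff = solve 4 (λ a b c d →
      (a :+ b) :- (c :+ d) := (a :- c) :+ (b :- d)) refl

    *-diff : ∀ a b c d →
      (a ℚ.* b) ℚ.- (c ℚ.* d) ≡ a ℚ.* (b ℚ.- d) ℚ.+ d ℚ.* (a ℚ.- c)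
    *-diff = solve 4 (λ a b c d →
      (a :* b) :- (c :* d) := a :* (b :- d) :+ d :* (a :- c)) refl

    split : ∀ a b → a ≡ (a ℚ.- b) ℚ.+ b
    split = solve 2 (λ a b → a := (a :- b) :+ b) refl

  open ℚ-Arith

  quotient : ∀ K → Positive K → ∀ ε → 0ℚ ℚ.< ε →
             ∃ λ δ → 0ℚ ℚ.< δ × K ℚ.* δ ≡ ε
  quotient K K>0 ε 0<ε =
    1/K ℚ.* ε , ℚ.positive⁻¹ _ {{δ>0}} ,
    trans (sym (ℚ.*-assoc K 1/K ε))
      (trans (cong (ℚ._* ε) (ℚ.*-inverseʳ K {{K≢0}})) (ℚ.*-identityˡ ε))
    where
    K≢0 : ℚ.NonZero K
    K≢0 = ℚ.pos⇒nonZero K {{K>0}}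
    1/K : ℚ
    1/K = (ℚ.1/ K) {{K≢0}}
    δ>0 : Positive (1/K ℚ.* ε)
    δ>0 = ℚ.pos*pos⇒pos 1/K {{ℚ.1/pos⇒pos K {{K>0}}}} ε {{ℚ.positive 0<ε}}

  eventually-bounded : ∀ x → Cauchy x →
    ∃₂ λ B N → Positive B × (∀ n → N ℕ.≤ n → ∣ x n ∣ ℚ.≤ B)
  eventually-bounded x cx with cx 1ℚ (ℚ.positive⁻¹ 1ℚ)
  ... | N , close = 1ℚ ℚ.+ ∣ x N ∣ , N
      , ℚ.pos+nonNeg⇒pos 1ℚ ∣ x N ∣ {{ℚ.∣-∣-nonNeg (x N)}}
      , λ n N≤n → begin
        ∣ x n ∣                     ≡⟨ cong ∣_∣ (split (x n) (x N)) ⟩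
        ∣ (x n ℚ.- x N) ℚ.+ x N ∣   ≤⟨ ℚ.∣p+q∣≤∣p∣+∣q∣ (x n ℚ.- x N) (x N) ⟩
        ∣ x n ℚ.- x N ∣ ℚ.+ ∣ x N ∣ ≤⟨ ℚ.+-monoˡ-≤ ∣ x N ∣
                                        (ℚ.<⇒≤ (close n N N≤n ℕ.≤-refl)) ⟩
        1ℚ ℚ.+ ∣ x N ∣              ∎
    where open ℚ.≤-Reasoning

  scale-< : ∀ B → Positive B → ∀ a b {δ} → ∣ a ∣ ℚ.≤ B → ∣ b ∣ ℚ.< δ →
            ∣ a ℚ.* b ∣ ℚ.< B ℚ.* δ
  scale-< B B>0 a b {δ} a≤B b<δ = begin-strict
    ∣ a ℚ.* b ∣     ≡⟨ ℚ.∣p*q∣≡∣p∣*∣q∣ a b ⟩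
    ∣ a ∣ ℚ.* ∣ b ∣ ≤⟨ ℚ.*-monoʳ-≤-nonNeg ∣ b ∣ {{ℚ.∣-∣-nonNeg b}} a≤B ⟩
    B ℚ.* ∣ b ∣     <⟨ ℚ.*-monoʳ-<-pos B {{B>0}} b<δ ⟩
    B ℚ.* δ         ∎
    where open ℚ.≤-Reasoning

  +-cauchy : ∀ x y → Cauchy x → Cauchy y → Cauchy (λ n → x n ℚ.+ y n)
  +-cauchy x y cx cy ε 0<ε with quotient (1ℚ ℚ.+ 1ℚ) _ ε 0<ε
  ... | δ , 0<δ , 2δ≡ε with cx δ 0<δ | cy δ 0<δ
  ... | M , x-close | N , y-close = M ℕ.⊔ N , λ m n ≤m ≤n → begin-strict
    ∣ (x m ℚ.+ y m) ℚ.- (x n ℚ.+ y n) ∣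
      ≡⟨ cong ∣_∣ (+-diff (x m) (y m) (x n) (y n)) ⟩
    ∣ (x m ℚ.- x n) ℚ.+ (y m ℚ.- y n) ∣
      ≤⟨ ℚ.∣p+q∣≤∣p∣+∣q∣ (x m ℚ.- x n) (y m ℚ.- y n) ⟩
    ∣ x m ℚ.- x n ∣ ℚ.+ ∣ y m ℚ.- y n ∣
      <⟨ ℚ.+-mono-< (x-close m n (ℕ.m⊔n≤o⇒m≤o M N ≤m) (ℕ.m⊔n≤o⇒m≤o M N ≤n))
                    (y-close m n (ℕ.m⊔n≤o⇒n≤o M N ≤m) (ℕ.m⊔n≤o⇒n≤o M N ≤n)) ⟩
    δ ℚ.+ δ
      ≡⟨ cong₂ ℚ._+_ (ℚ.*-identityˡ δ) (ℚ.*-identityˡ δ) ⟨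
    1ℚ ℚ.* δ ℚ.+ 1ℚ ℚ.* δ
      ≡⟨ ℚ.*-distribʳ-+ δ 1ℚ 1ℚ ⟨
    (1ℚ ℚ.+ 1ℚ) ℚ.* δ
      ≡⟨ 2δ≡ε ⟩
    ε ∎
    where open ℚ.≤-Reasoning

  *-close : ∀ B C {δ} → Positive B → Positive C → ∀ a b c d →
            ∣ a ∣ ℚ.≤ B → ∣ d ∣ ℚ.≤ C → ∣ a ℚ.- c ∣ ℚ.< δ → ∣ b ℚ.- d ∣ ℚ.< δ →
            ∣ a ℚ.* b ℚ.- c ℚ.* d ∣ ℚ.< (B ℚ.+ C) ℚ.* δ
  *-close B C {δ} B>0 C>0 a b c d a≤B d≤C a-c<δ b-d<δ = begin-strict
    ∣ a ℚ.* b ℚ.- c ℚ.* d ∣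
      ≡⟨ cong ∣_∣ (*-diff a b c d) ⟩
    ∣ a ℚ.* (b ℚ.- d) ℚ.+ d ℚ.* (a ℚ.- c) ∣
      ≤⟨ ℚ.∣p+q∣≤∣p∣+∣q∣ (a ℚ.* (b ℚ.- d)) (d ℚ.* (a ℚ.- c)) ⟩
    ∣ a ℚ.* (b ℚ.- d) ∣ ℚ.+ ∣ d ℚ.* (a ℚ.- c) ∣
      <⟨ ℚ.+-mono-< (scale-< B B>0 a (b ℚ.- d) a≤B b-d<δ)
                    (scale-< C C>0 d (a ℚ.- c) d≤C a-c<δ) ⟩
    B ℚ.* δ ℚ.+ C ℚ.* δ
      ≡⟨ ℚ.*-distribʳ-+ δ B C ⟨
    (B ℚ.+ C) ℚ.* δ ∎
    where open ℚ.≤-Reasoning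

  *-cauchy : ∀ x y → Cauchy x → Cauchy y → Cauchy (λ n → x n ℚ.* y n)
  *-cauchy x y cx cy ε 0<ε =
    let B , K , B>0 , x≤B = eventually-bounded x cx
        C , L , C>0 , y≤C = eventually-bounded y cy
        δ , 0<δ , [B+C]δ≡ε =
          quotient (B ℚ.+ C) (ℚ.pos+pos⇒pos B {{B>0}} C {{C>0}}) ε 0<ε
        M , x-close = cx δ 0<δ
        N , y-close = cy δ 0<δ
    in (K ℕ.⊔ L) ℕ.⊔ (M ℕ.⊔ N) , λ m n ≤m ≤n →
      let KL≤m = ℕ.m⊔n≤o⇒m≤o (K ℕ.⊔ L) (M ℕ.⊔ N) ≤m
          KL≤n = ℕ.m⊔n≤o⇒m≤o (K ℕ.⊔ L) (M ℕ.⊔ N) ≤n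
          MN≤m = ℕ.m⊔n≤o⇒n≤o (K ℕ.⊔ L) (M ℕ.⊔ N) ≤m
          MN≤n = ℕ.m⊔n≤o⇒n≤o (K ℕ.⊔ L) (M ℕ.⊔ N) ≤n
      in subst (∣ x m ℚ.* y m ℚ.- x n ℚ.* y n ∣ ℚ.<_) [B+C]δ≡ε
           (*-close B C B>0 C>0 (x m) (y m) (x n) (y n)
             (x≤B m (ℕ.m⊔n≤o⇒m≤o K L KL≤m))
             (y≤C n (ℕ.m⊔n≤o⇒n≤o K L KL≤n))
             (x-close m n (ℕ.m⊔n≤o⇒m≤o M N MN≤m) (ℕ.m⊔n≤o⇒m≤o M N MN≤n))
             (y-close m n (ℕ.m⊔n≤o⇒n≤o M N MN≤m) (ℕ.m⊔n≤o⇒n≤o M N MN≤n)))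

open CauchyProperties

_+ᵣ_ : ℝ → ℝ → ℝ
x +ᵣ y = mkℝ (λ n → seq x n ℚ.+ seq y n)
             (+-cauchy (seq x) (seq y) (cauchy x) (cauchy y))

_*ᵣ_ : ℝ → ℝ → ℝ
x *ᵣ y = mkℝ (λ n → seq x n ℚ.* seq y n)
             (*-cauchy (seq x) (seq y) (cauchy x) (cauchy y))

------------------------------------------------------------------------
-- Real eigenvalues of square matrices

Matrix : ℕ → Set
Matrix n = Fin n → Fin n → ℝ

sumᵣ : ∀ {n} → Vector ℝ n → ℝ
sumᵣ = foldr _+ᵣ_ 0ᵣ

_*ᵥ_ : ∀ {n} → Matrix n → Vector ℝ n → Vector ℝ n
(A *ᵥ v) i = sumᵣ λ j → A i j *ᵣ v j

IsEigenvalue : ∀ {n} → Matrix n → ℝ → Set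
IsEigenvalue {n} A μ = Σ (Vector ℝ n) λ v →
  ¬ (∀ i → v i ≈ᵣ 0ᵣ) × (∀ i → (A *ᵥ v) i ≈ᵣ μ *ᵣ v i)

------------------------------------------------------------------------
-- Finite simple graphs

-- Vertices form a setoid because permutations are compared pointwise.
-- Adjacency is decidable, as it must be for a 0-1 matrix to exist.
record FiniteSimpleGraph : Set₁ where
  field
    vertices    : Setoid 0ℓ 0ℓ

  open Setoid vertices public
    using () renaming (Carrier to Vertex; _≈_ to _≈ⱽ_)

  infix 4 _~_
  field
    order       : ℕ
    enumeration : Inverse (setoid (Fin order)) vertices
    _~_         : Rel Vertex 0ℓ
    ~-resp-≈    : _~_ Respects₂ _≈ⱽ_
    ~-sym       : Symmetric _~_
    ~-irrefl    : ∀ {u} → ¬ (u ~ u)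
    _~?_        : Decidable _~_

open FiniteSimpleGraph using (Vertex; vertices)

adjacencyMatrix : (G : FiniteSimpleGraph) → Matrix (FiniteSimpleGraph.order G)
adjacencyMatrix G i j =
  if does (Inverse.to enumeration i ~? Inverse.to enumeration j) then 1ᵣ else 0ᵣ
  where open FiniteSimpleGraph G

-- The adjacency matrix is real symmetric, so its eigenvalues are real.
Integral : FiniteSimpleGraph → Set
Integral G = ∀ μ → IsEigenvalue (adjacencyMatrix G) μ → ∃ λ z → μ ≈ᵣ fromℤ z

infix 4 _≅_

_≅_ : FiniteSimpleGraph → FiniteSimpleGraph → Set
G ≅ H = Σ (Inverse (vertices G) (vertices H)) λ f →
  ∀ u v → (u G.~ v) ⇔ (Inverse.to f u H.~ Inverse.to f v)
  where
  module G = FiniteSimpleGraph G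
  module H = FiniteSimpleGraph H

------------------------------------------------------------------------
-- Cycle graphs

-- j = i + 1 modulo m.
Next : ∀ {m} → Rel (Fin m) 0ℓ
Next {m} i j = toℕ j ≡ suc (toℕ i) ⊎ (suc (toℕ i) ≡ m × toℕ j ≡ 0)

cycleGraph : ∀ m → 3 ℕ.≤ m → FiniteSimpleGraph
cycleGraph m 3≤m = record
  { vertices    = setoid (Fin m)
  ; order       = m
  ; enumeration = Identity.inverse (setoid (Fin m))
  ; _~_         = λ i j → Next i j ⊎ Next j i
  ; ~-resp-≈    = (λ { refl p → p }) , (λ { refl p → p })
  ; ~-sym       = swap
  ; ~-irrefl    = λ { (inj₁ p) → ¬Next 3≤m p ; (inj₂ p) → ¬Next 3≤m p }
  ; _~?_        = λ i j → next? i j ⊎-dec next? j i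
  }
  where
  ¬Next : ∀ {m} {i : Fin m} → 3 ℕ.≤ m → ¬ Next i i
  ¬Next _ (inj₁ i≡1+i) = ℕ.1+n≢n (sym i≡1+i)
  ¬Next 3≤m (inj₂ (1+i≡m , i≡0)) with trans (sym 1+i≡m) (cong suc i≡0)
  ¬Next (s≤s ()) (inj₂ _) | refl

  next? : ∀ {m} → Decidable (Next {m})
  next? {m} i j = (toℕ j ℕ.≟ suc (toℕ i))
    ⊎-dec ((suc (toℕ i) ℕ.≟ m) ×-dec (toℕ j ℕ.≟ 0))

------------------------------------------------------------------------
-- Cayley graphs of finite groups

record IsConnectionSet (G : Group 0ℓ 0ℓ) (S : Pred (Group.Carrier G) 0ℓ) : Set where
  open Group G
  field
    resp       : S Respects _≈_
    dec        : Unary.Decidable S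
    ε∉         : ¬ S ε
    ⁻¹-closed  : ∀ {g} → S g → S (g ⁻¹)

Cay : (G : Group 0ℓ 0ℓ) {n : ℕ} → Inverse (setoid (Fin n)) (Group.setoid G) →
      (S : Pred (Group.Carrier G) 0ℓ) → IsConnectionSet G S → FiniteSimpleGraph
Cay G {n} enum S conn = record
  { vertices    = Group.setoid G
  ; order       = n
  ; enumeration = enum
  ; _~_         = λ g₁ g₂ → S (g₁ ∙ g₂ ⁻¹)
  ; ~-resp-≈    = (λ h≈h′ → resp (∙-congˡ (⁻¹-cong h≈h′)))
                , (λ g≈g′ → resp (∙-congʳ g≈g′))
  ; ~-sym       = λ {g} {h} s → resp (⁻¹-anti-homo-// g h) (⁻¹-closed s)
  ; ~-irrefl    = λ {g} s → ε∉ (resp (inverseʳ g) s)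
  ; _~?_        = λ g₁ g₂ → dec (g₁ ∙ g₂ ⁻¹)
  }
  where
  open Group G hiding (refl; sym; trans)
  open IsConnectionSet conn
  open GroupProperties G using (⁻¹-anti-homo-//)

------------------------------------------------------------------------
-- The symmetric group

-- (σ ∙ τ) i = σ (τ i), whereas _∘ₚ_ applies its left argument first.
Sym : ℕ → Group 0ℓ 0ℓ
Sym m = record
  { Carrier = Permutation′ m
  ; _≈_     = Perm._≈_
  ; _∙_     = λ σ τ → τ ∘ₚ σ
  ; ε       = Perm.id
  ; _⁻¹     = flip
  ; isGroup = record
    { isMonoid = record
      { isSemigroup = record
        { isMagma = record
          { isEquivalence = record
            { refl  = λ _ → refl
            ; sym   = λ p i → sym (p i)
            ; trans = λ p q i → trans (p i) (q i)
            }
          ; ∙-cong = λ {σ} {σ′} {τ} {τ′} p q i →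
              trans (cong (σ ⟨$⟩ʳ_) (q i)) (p (τ′ ⟨$⟩ʳ i))
          }
        ; assoc = λ _ _ _ _ → refl
        }
      ; identity = (λ _ _ → refl) , (λ _ _ → refl)
      }
    ; inverse = (λ σ _ → Perm.inverseˡ σ) , (λ σ _ → Perm.inverseʳ σ)
    ; ⁻¹-cong = λ {σ} {τ} p i →
        trans (cong (σ ⟨$⟩ˡ_)
                (sym (trans (p (τ ⟨$⟩ˡ i)) (Perm.inverseʳ τ))))
              (Perm.inverseˡ σ)
    }
  }

module Enumeration where
  remove-cong : ∀ {n} (π ρ : Permutation′ (suc n)) → π Perm.≈ ρ →
                remove zero π Perm.≈ remove zero ρ
  remove-cong π ρ π≈ρ j = punchIn-injective (ρ ⟨$⟩ʳ zero) _ _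
    (trans (cong (λ k → punchIn k (remove zero π ⟨$⟩ʳ j)) (sym (π≈ρ zero)))
    (trans (sym (punchIn-permute π zero j))
    (trans (π≈ρ (suc j)) (punchIn-permute ρ zero j))))

  insert-cong : ∀ {n} (i : Fin (suc n)) (π ρ : Permutation′ n) → π Perm.≈ ρ →
                insert zero i π Perm.≈ insert zero i ρ
  insert-cong i π ρ π≈ρ zero    = refl
  insert-cong i π ρ π≈ρ (suc k) = cong (punchIn i) (π≈ρ k)

  decode : ∀ m → Fin (m !) → Permutation′ m
  decode⁺ : ∀ n → Fin (suc n) × Fin (n !) → Permutation′ (suc n)

  decode zero    _ = Perm.id
  decode (suc n) k = decode⁺ n (remQuot (n !) k)
  decode⁺ n (i , r) = insert zero i (decode n r)

  encode : ∀ m → Permutation′ m → Fin (m !)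
  encode zero    _ = zero
  encode (suc n) π = combine (π ⟨$⟩ʳ zero) (encode n (remove zero π))

  encode-cong : ∀ m (π ρ : Permutation′ m) → π Perm.≈ ρ → encode m π ≡ encode m ρ
  encode-cong zero    _ _ _   = refl
  encode-cong (suc n) π ρ π≈ρ = cong₂ combine (π≈ρ zero)
    (encode-cong n (remove zero π) (remove zero ρ) (remove-cong π ρ π≈ρ))

  decode-encode : ∀ m (π : Permutation′ m) → decode m (encode m π) Perm.≈ π
  decode-encode zero    π ()
  decode-encode (suc n) π i = trans
    (cong (λ p → decode⁺ n p ⟨$⟩ʳ i) (remQuot-combine (π ⟨$⟩ʳ zero) r))
    (trans (insert-cong (π ⟨$⟩ʳ zero) (decode n r) (remove zero π)
              (decode-encode n (remove zero π)) i)
           (insert-remove zero π i))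
    where
    r : Fin (n !)
    r = encode n (remove zero π)

  encode-decode : ∀ m (k : Fin (m !)) → encode m (decode m k) ≡ k
  encode-decode zero    zero = refl
  encode-decode (suc n) k = trans
    (cong (combine i)
      (trans (encode-cong n (remove zero (insert zero i (decode n r))) (decode n r)
                (remove-insert zero i (decode n r)))
             (encode-decode n r)))
    (combine-remQuot {suc n} (n !) k)
    where
    i : Fin (suc n)
    i = proj₁ (remQuot {suc n} (n !) k)
    r : Fin (n !)
    r = proj₂ (remQuot {suc n} (n !) k)

open Enumeration

Sym-enumeration : ∀ m → Inverse (setoid (Fin (m !))) (Group.setoid (Sym m))
Sym-enumeration m = record
  { to        = decode m
  ; from      = encode m
  ; to-cong   = λ { refl _ → refl }
  ; from-cong = λ {π} {ρ} → encode-cong m π ρ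
  ; inverse   =
      (λ {π} {k} k≡ i →
        trans (cong (λ l → decode m l ⟨$⟩ʳ i) k≡) (decode-encode m π i))
    , (λ {k} {π} π≈ → trans (encode-cong m π (decode m k) π≈) (encode-decode m k))
  }

------------------------------------------------------------------------
-- Sets of transpositions

IsTransposition : ∀ {m} → Permutation′ m → Set
IsTransposition π = ∃₂ λ i j → i ≢ j × π Perm.≈ transpose i j

record TranspositionSet (m : ℕ) : Set₁ where
  field
    member          : Pred (Permutation′ m) 0ℓ
    resp            : member Respects Perm._≈_
    dec             : Unary.Decidable member
    isTransposition : ∀ {π} → member π → IsTransposition π

module TranspositionProperties where
  transpose-self : ∀ {m} (i : Fin m) → transpose i i Perm.≈ Perm.id
  transpose-self i k with k Fin.≟ i
  ... | yes k≡i = sym k≡i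
  ... | no  k≢i rewrite dec-no (k Fin.≟ i) k≢i = refl

  transpose-comm : ∀ {m} (i j : Fin m) → transpose i j Perm.≈ transpose j i
  transpose-comm i j k with k Fin.≟ i in p | k Fin.≟ j in q
  ... | yes k≡i | yes k≡j = trans (sym k≡j) k≡i
  ... | yes _   | no  _   rewrite p = refl
  ... | no  _   | yes _   rewrite q = refl
  ... | no  _   | no  _   rewrite p | q = refl

  transpose-matchˡ : ∀ {m} (i j : Fin m) → transpose i j ⟨$⟩ʳ i ≡ j
  transpose-matchˡ i j rewrite dec-true (i Fin.≟ i) refl = refl

  id-not-transposition : ∀ {m} → ¬ IsTransposition (Perm.id {m})
  id-not-transposition (i , j , i≢j , id≈) =
    i≢j (trans (id≈ i) (transpose-matchˡ i j))

open TranspositionProperties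

transpositionGraph : ∀ {m} → TranspositionSet m → FiniteSimpleGraph
transpositionGraph {m} T = record
  { vertices    = setoid (Fin m)
  ; order       = m
  ; enumeration = Identity.inverse (setoid (Fin m))
  ; _~_         = λ i j → member (transpose i j)
  ; ~-resp-≈    = (λ { refl t → t }) , (λ { refl t → t })
  ; ~-sym       = λ {i} {j} →
      resp {transpose i j} {transpose j i} (transpose-comm i j)
  ; ~-irrefl    = λ {i} t →
      id-not-transposition
        (isTransposition (resp {transpose i i} {Perm.id} (transpose-self i) t))
  ; _~?_        = λ i j → dec (transpose i j)
  }
  where open TranspositionSet T

isConnectionSet : ∀ {m} (T : TranspositionSet m) →
                  IsConnectionSet (Sym m) (TranspositionSet.member T)
isConnectionSet {m} T = record
  { resp      = resp
  ; dec       = dec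
  ; ε∉        = id-not-transposition ∘ isTransposition
  ; ⁻¹-closed = λ {π} t →
      resp {π} {flip π} (involution {π} (isTransposition t)) t
  }
  where
  open TranspositionSet T
  open Group (Sym m) using (_≈_; ⁻¹-cong)
  involution : ∀ {π} → IsTransposition π → π ≈ flip π
  involution {π} (i , j , _ , π≈) k = trans (π≈ k)
    (trans (transpose-comm i j k) (sym (⁻¹-cong {π} {transpose i j} π≈ k)))

CayleySym : ∀ {m} → TranspositionSet m → FiniteSimpleGraph
CayleySym {m} T =
  Cay (Sym m) (Sym-enumeration m) (TranspositionSet.member T) (isConnectionSet T)

{-# OPTIONS --safe #-}

-- The neighbours of σ in Cay(S_m, T) are the tσ with t ∈ T, so a function of the
-- images σ(x), σ(y) is an eigenvector as soon as it is one for the action of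
-- Σ_{t ∈ T} t on pairs of points.
--
-- For one point this action is m - 2 plus the adjacency matrix of C_m, with eigenvalues
-- m - 4 + x², x = 2 cos (πj/m). The polynomial U · m with these roots x is rational, so
-- a root can be located by bisection; for m = 5 and for m ≥ 7 there is one whose square
-- lies strictly between consecutive integers, the largest one, 2 cos (π/m). For m = 6
-- all these eigenvalues are integers, but two points give the eigenvalue 1 + √5.
--
-- For m = 3 and m = 4 the product of the Σ_{t ∈ T} t - κ over the expected eigenvalues κ
-- vanishes in the integral group ring, which is a finite computation.

module Submission where

open import Defs
open import Algebra.Bundles using (CommutativeRing)
import Algebra.Properties.CommutativeSemigroup as CommutativeSemigroupProperties
import Algebra.Properties.Group as GroupProperties
import Algebra.Properties.Semiring.Sum as SemiringSum
open import Algebra.Structures using (IsCommutativeRing)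
open import Data.Bool.Base using (true; false; if_then_else_)
open import Data.Fin.Base using (Fin; zero; suc; toℕ; fromℕ; inject₁)
open import Data.Fin.Patterns using (0F; 1F)
open import Data.Fin.Permutation as Perm
  using (Permutation′; _⟨$⟩ʳ_; _⟨$⟩ˡ_; _∘ₚ_; flip; transpose; permutation)
import Data.Fin.Permutation.Components as Components
import Data.Fin.Properties as Fin
open import Data.Fin.Relation.Unary.Top
  using (view; ‵fromℕ; ‵inject₁; view-fromℕ; view-inject₁)
open import Data.Integer.Base as ℤ using (ℤ; +_; -[1+_]; 0ℤ; 1ℤ)
import Data.Integer.Properties as ℤ
open import Data.List.Base using (List; []; _∷_; foldr)
open import Data.List.Relation.Unary.All as All using (All; []; _∷_)
open import Data.List.Relation.Unary.AllPairs using (AllPairs; []; _∷_; allPairs?)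
open import Data.Nat.Base as ℕ using (ℕ; zero; suc; z≤n; s≤s; _!; _≤_)
import Data.Nat.Properties as ℕ
open import Data.Product.Base using (∃; ∃₂; _×_; _,_; proj₁; proj₂)
open import Data.Rational.Base as ℚ using (ℚ; 0ℚ; 1ℚ; ∣_∣; mkℚ)
import Data.Rational.Literals as Literals
import Data.Rational.Properties as ℚ
open import Data.Rational.Solver using (module +-*-Solver)
open import Data.Sum.Base using (_⊎_; inj₁; inj₂)
open import Data.Unit.Base using (tt)
open import Data.Vec.Base as Vec using (Vec; lookup; tabulate)
open import Data.Vec.Functional as Vector using (Vector; removeAt)
open import Data.Vec.Properties using (lookup∘tabulate; lookup-replicate)
open import Function.Base using (_∘_)
open import Function.Bundles using (Inverse; Equivalence; _⇔_; mk⇔)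
open import Level using (0ℓ)
open import Relation.Binary.PropositionalEquality
  using (_≡_; _≢_; refl; sym; trans; cong; cong₂; subst; subst₂)
import Relation.Binary.Reasoning.Setoid as SetoidReasoning
open import Relation.Nullary using (¬_; Dec; yes; no; does; contradiction)
open import Relation.Nullary.Decidable using (dec-true; dec-false; toWitness; _×-dec_)

open CauchyProperties using (quotient; eventually-bounded; *-close)
open CauchyProperties.ℚ-Arith using (+-diff; split)
open Enumeration
open TranspositionProperties
open +-*-Solver using (solve; con; _:+_; _:*_; _:-_; :-_; _:=_)

-- Transpositions and the standard cycle

-- The reals are Cauchy sequences, for which neither equality nor order is decidable, and this
-- shapes both directions. Against integrality an eigenvalue has to be exhibited as a Cauchy
-- sequence: no cosine is constructed, signs are tested at rational points only, and rational bounds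
-- on every term keep the limit away from the integers. For integrality a real μ has to be
-- identified with an integer although the eigenvector is only known not to vanish everywhere, so
-- that there is no coordinate to divide by. Each expected eigenvalue is therefore tested
-- approximately; since these lie at distance at least 1 from each other, all factors but one can be
-- cancelled. The largest root serves all m ≥ 7 at once because 2 cos (π/m) increases to 2 and its
-- square exceeds 3 from m = 7 on. The square is exactly 3 for m = 6 and about 2.618 for m = 5,
-- hence the separate treatment.

transpose-matchʳ : ∀ {m} (i j : Fin m) → transpose i j ⟨$⟩ʳ j ≡ i
transpose-matchʳ i j = trans (transpose-comm i j j) (transpose-matchˡ j i)

transpose-fix : ∀ {m} {i j k : Fin m} → k ≢ i → k ≢ j → transpose i j ⟨$⟩ʳ k ≡ k
transpose-fix {i = i} {j} {k} k≢i k≢j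
  rewrite dec-false (k Fin.≟ i) k≢i | dec-false (k Fin.≟ j) k≢j = refl

transpose-involutive : ∀ {m} (i j k : Fin m) → transpose i j ⟨$⟩ʳ (transpose i j ⟨$⟩ʳ k) ≡ k
transpose-involutive i j k = trans
  (cong (transpose i j ⟨$⟩ʳ_) (transpose-comm i j k)) (Components.transpose-inverse i j)

-- The conjugation formula π (π⁻¹i π⁻¹j) π⁻¹ = (i j). It carries the transpositions of T to the
-- edges of the standard cycle.
transpose-conjugate : ∀ {m} (π : Permutation′ m) i j k →
  π ⟨$⟩ʳ (transpose (π ⟨$⟩ˡ i) (π ⟨$⟩ˡ j) ⟨$⟩ʳ k) ≡ transpose i j ⟨$⟩ʳ (π ⟨$⟩ʳ k)
transpose-conjugate π i j k = by-cases (k Fin.≟ π ⟨$⟩ˡ i) (k Fin.≟ π ⟨$⟩ˡ j)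
  where
  i′ = π ⟨$⟩ˡ i
  j′ = π ⟨$⟩ˡ j
  πi′≡i : π ⟨$⟩ʳ i′ ≡ i
  πi′≡i = Perm.inverseʳ π
  πj′≡j : π ⟨$⟩ʳ j′ ≡ j
  πj′≡j = Perm.inverseʳ π
  k≢ : ∀ l → k ≢ π ⟨$⟩ˡ l → π ⟨$⟩ʳ k ≢ l
  k≢ l k≢l πk≡l = k≢l (trans (sym (Perm.inverseˡ π)) (cong (π ⟨$⟩ˡ_) πk≡l))
  by-cases : Dec (k ≡ i′) → Dec (k ≡ j′) →
    π ⟨$⟩ʳ (transpose i′ j′ ⟨$⟩ʳ k) ≡ transpose i j ⟨$⟩ʳ (π ⟨$⟩ʳ k)
  by-cases (yes k≡i′) _ = trans
    (cong (λ l → π ⟨$⟩ʳ (transpose i′ j′ ⟨$⟩ʳ l)) k≡i′)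
    (trans (cong (π ⟨$⟩ʳ_) (transpose-matchˡ i′ j′)) (trans πj′≡j
      (sym (trans (cong (transpose i j ⟨$⟩ʳ_) (trans (cong (π ⟨$⟩ʳ_) k≡i′) πi′≡i))
                  (transpose-matchˡ i j)))))
  by-cases (no _) (yes k≡j′) = trans
    (cong (λ l → π ⟨$⟩ʳ (transpose i′ j′ ⟨$⟩ʳ l)) k≡j′)
    (trans (cong (π ⟨$⟩ʳ_) (transpose-matchʳ i′ j′)) (trans πi′≡i
      (sym (trans (cong (transpose i j ⟨$⟩ʳ_) (trans (cong (π ⟨$⟩ʳ_) k≡j′) πj′≡j))
                  (transpose-matchʳ i j)))))
  by-cases (no k≢i′) (no k≢j′) = trans
    (cong (π ⟨$⟩ʳ_) (transpose-fix k≢i′ k≢j′))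
    (sym (transpose-fix (k≢ i k≢i′) (k≢ j k≢j′)))

next : ∀ {n} → Fin (suc n) → Fin (suc n)
next i with view i
... | ‵fromℕ     = zero
... | ‵inject₁ j = suc j

prev : ∀ {n} → Fin (suc n) → Fin (suc n)
prev zero    = fromℕ _
prev (suc i) = inject₁ i

next-fromℕ : ∀ n → next (fromℕ n) ≡ zero
next-fromℕ n rewrite view-fromℕ n = refl

next-inject₁ : ∀ {n} (i : Fin n) → next (inject₁ i) ≡ suc i
next-inject₁ i rewrite view-inject₁ i = refl

next-prev : ∀ {n} (i : Fin (suc n)) → next (prev i) ≡ i
next-prev zero    = next-fromℕ _
next-prev (suc i) = next-inject₁ i

prev-next : ∀ {n} (i : Fin (suc n)) → prev (next i) ≡ i
prev-next i with view i
... | ‵fromℕ     = refl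
... | ‵inject₁ j = refl

Next-next : ∀ {n} (i : Fin (suc n)) → Next i (next i)
Next-next i with view i
... | ‵fromℕ {n} = inj₂ (cong suc (Fin.toℕ-fromℕ n) , refl)
... | ‵inject₁ j = inj₁ (cong suc (sym (Fin.toℕ-inject₁ j)))

Next-unique : ∀ {n} {i j : Fin (suc n)} → Next i j → j ≡ next i
Next-unique {i = i} {j} i→j = Fin.toℕ-injective (same i→j (Next-next i))
  where
  same : Next i j → Next i (next i) → toℕ j ≡ toℕ (next i)
  same (inj₁ p)       (inj₁ q)       = trans p (sym q)
  same (inj₂ (_ , p)) (inj₂ (_ , q)) = trans p (sym q)
  same (inj₁ p) (inj₂ (1+i≡m , _)) =
    contradiction (trans p 1+i≡m) (ℕ.<⇒≢ (Fin.toℕ<n j))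
  same (inj₂ (1+i≡m , _)) (inj₁ q) =
    contradiction (trans q 1+i≡m) (ℕ.<⇒≢ (Fin.toℕ<n (next i)))

next≢ : ∀ {n} (i : Fin (2 ℕ.+ n)) → next i ≢ i
next≢ i next≡ with view i
next≢ .(fromℕ _)   ()    | ‵fromℕ
... | ‵inject₁ j = ℕ.1+n≢n (trans (cong toℕ next≡) (Fin.toℕ-inject₁ j))

next-next≢ : ∀ {n} (i : Fin (3 ℕ.+ n)) → next (next i) ≢ i
next-next≢ {n} i eq = absurd (Next-next i) (Next-next (next i))
  where
  back : toℕ (next (next i)) ≡ toℕ i
  back = cong toℕ eq
  absurd : Next i (next i) → ¬ Next (next i) (next (next i))
  absurd (inj₁ p)       (inj₁ q)       = ℕ.<⇒≢ (ℕ.m≤n⇒m≤1+n ℕ.≤-refl)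
    (trans (sym back) (trans q (cong suc p)))
  absurd (inj₁ p)       (inj₂ (q , r)) = contradiction
    (trans (sym q) (cong suc (trans p (cong suc (trans (sym back) r))))) λ ()
  absurd (inj₂ (p , r)) (inj₁ q)       = contradiction
    (trans (sym p) (cong suc (trans (sym back) (trans q (cong suc r))))) λ ()
  absurd (inj₂ (p , r)) (inj₂ (q , _)) = contradiction
    (trans (sym q) (cong suc r)) λ ()

edge : ∀ {n} → Fin (suc n) → Permutation′ (suc n)
edge k = transpose k (next k)

edge-here : ∀ {n} {p k : Fin (suc n)} → p ≡ k → edge k ⟨$⟩ʳ p ≡ next p
edge-here {p = p} refl = transpose-matchˡ p (next p)

edge-before : ∀ {n} {p k : Fin (suc n)} → prev p ≡ k → edge k ⟨$⟩ʳ p ≡ prev p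
edge-before {p = p} refl = trans
  (cong (edge (prev p) ⟨$⟩ʳ_) (sym (next-prev p)))
  (transpose-matchʳ (prev p) (next (prev p)))

edge-elsewhere : ∀ {n} {p k : Fin (suc n)} → p ≢ k → prev p ≢ k → edge k ⟨$⟩ʳ p ≡ p
edge-elsewhere {p = p} {k} p≢k prev≢k = transpose-fix p≢k λ p≡ →
  prev≢k (trans (cong prev p≡) (prev-next k))

-- Compare the images of k. The first transposition sends k to `next k`; if l ≠ k, the second fixes
-- k or sends it to `prev k`, and `next k` = `prev k` would force a cycle of length 2.
edge-injective : ∀ {n} (k l : Fin (3 ℕ.+ n)) → edge k Perm.≈ edge l → k ≡ l
edge-injective k l k≈l = by-cases (k Fin.≟ l) (prev k Fin.≟ l)
  where
  edge-l-k : edge l ⟨$⟩ʳ k ≡ next k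
  edge-l-k = trans (sym (k≈l k)) (edge-here refl)
  by-cases : Dec (k ≡ l) → Dec (prev k ≡ l) → k ≡ l
  by-cases (yes k≡l) _ = k≡l
  by-cases (no k≢l) (yes prev≡l) = contradiction
    (trans (cong next (trans (sym edge-l-k) (edge-before {p = k} prev≡l))) (next-prev k))
    (next-next≢ k)
  by-cases (no k≢l) (no prev≢l) = contradiction
    (trans (sym edge-l-k) (edge-elsewhere {p = k} k≢l prev≢l)) (next≢ k)

-- Sums and eigenvectors over a commutative ring

i-j+j≡i : ∀ i j → (i ℤ.- j) ℤ.+ j ≡ i
i-j+j≡i i j = trans (ℤ.+-assoc i (ℤ.- j) j)
  (trans (cong (λ k → i ℤ.+ k) (ℤ.+-inverseˡ j)) (ℤ.+-identityʳ i))

ℤ-sum : ∀ {n} → Vector ℤ n → ℤ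
ℤ-sum = SemiringSum.sum (CommutativeRing.semiring ℤ.+-*-commutativeRing)

-- run ks c is the row vector c times the product of the B - κ, κ ∈ ks, where B is the
-- matrix with B u = Σ_k u ∘ h k; it is symmetric when the h k are involutions.
module RowReduction {n r} (h : Fin r → Fin n → Fin n) where

  step : ℤ → Vec ℤ n → Vec ℤ n
  step κ c = tabulate λ j →
    ℤ-sum (λ k → lookup c (h k j)) ℤ.+ ℤ.- κ ℤ.* lookup c j

  run : List ℤ → Vec ℤ n → Vec ℤ n
  run ks c = foldr step c ks

  basis : Fin n → Vec ℤ n
  basis i = tabulate λ j → if does (i Fin.≟ j) then 1ℤ else 0ℤ

module RingLemmas (R : CommutativeRing 0ℓ 0ℓ) where
  open CommutativeRing R renaming (refl to ≈-refl; sym to ≈-sym; trans to ≈-trans)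
  open GroupProperties +-group using (∙-cancelʳ)
  open CommutativeSemigroupProperties +-commutativeSemigroup
    using () renaming (x∙yz≈y∙xz to x+yz≈y+xz)
  open CommutativeSemigroupProperties *-commutativeSemigroup
    using () renaming (x∙yz≈y∙xz to x*yz≈y*xz)
  open SemiringSum semiring public
    using (sum; sum-cong-≋; sum-cong-≗; sum-remove; sum-replicate-zero; ∑-comm;
           ∑-distrib-+; *-distribˡ-sum; *-distribʳ-sum; sum-permute)
  open SetoidReasoning setoid

  sum-zero : ∀ {n} (f : Vector Carrier n) → (∀ i → f i ≈ 0#) → sum f ≈ 0#
  sum-zero {n} f f≈0 = ≈-trans (sum-cong-≋ f≈0) (sum-replicate-zero n)

  sum-single : ∀ {n} (f : Vector Carrier n) i → (∀ j → j ≢ i → f j ≈ 0#) → sum f ≈ f i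
  sum-single {suc n} f i f≈0 = begin
    sum f                      ≈⟨ sum-remove {i = i} f ⟩
    f i + sum (removeAt f i)   ≈⟨ +-congˡ (sum-zero _ λ j → f≈0 _ (Fin.punchInᵢ≢i i j)) ⟩
    f i + 0#                   ≈⟨ +-identityʳ (f i) ⟩
    f i                        ∎

  only-if : ∀ {A : Set} → Dec A → Carrier → Carrier
  only-if a? x = if does a? then x else 0#

  only-if-yes : ∀ {A : Set} (a? : Dec A) {x} → A → only-if a? x ≡ x
  only-if-yes a? a rewrite dec-true a? a = refl

  only-if-no : ∀ {A : Set} (a? : Dec A) {x} → ¬ A → only-if a? x ≡ 0#
  only-if-no a? ¬a rewrite dec-false a? ¬a = refl

  sum-only-if : ∀ {n} (i : Fin n) (f : Vector Carrier n) →
                sum (λ j → only-if (i Fin.≟ j) (f j)) ≈ f i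
  sum-only-if i f = ≈-trans
    (sum-single _ i λ j j≢i → reflexive (only-if-no (i Fin.≟ j) (j≢i ∘ sym)))
    (reflexive (only-if-yes (i Fin.≟ i) refl))

  -- Each indicator is a sum over k of delta functions at `g k`, exactly one of which is nonzero
  -- when `P j` holds; then the two sums are exchanged. This turns a row of an adjacency matrix into
  -- a sum over generators.
  sum-over-image : ∀ {r n} {P : Fin n → Set} (P? : ∀ j → Dec (P j)) (g : Fin r → Fin n) →
    (∀ k l → g k ≡ g l → k ≡ l) → (∀ k → P (g k)) → (∀ j → P j → ∃ λ k → g k ≡ j) →
    ∀ (v : Vector Carrier n) →
    sum (λ j → (if does (P? j) then 1# else 0#) * v j) ≈ sum (λ k → v (g k))
  sum-over-image {r} {n} P? g g-inj P-g g-onto v = begin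
    sum (λ j → (if does (P? j) then 1# else 0#) * v j)   ≈⟨ sum-cong-≋ expand ⟩
    sum (λ j → sum (λ k → only-if (g k Fin.≟ j) (v j)))  ≈⟨ ∑-comm (λ j k → only-if (g k Fin.≟ j) (v j)) ⟩
    sum (λ k → sum (λ j → only-if (g k Fin.≟ j) (v j)))  ≈⟨ sum-cong-≋ (λ k → sum-only-if (g k) v) ⟩
    sum (λ k → v (g k))                                  ∎
    where
    expand : ∀ j → (if does (P? j) then 1# else 0#) * v j ≈ sum (λ k → only-if (g k Fin.≟ j) (v j))
    expand j with P? j
    ... | no ¬Pj = ≈-trans (zeroˡ (v j)) (≈-sym (sum-zero _ λ k →
      reflexive (only-if-no (g k Fin.≟ j) λ gk≡j → ¬Pj (subst _ gk≡j (P-g k)))))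
    ... | yes Pj with g-onto j Pj
    ... | l , refl = ≈-trans (*-identityˡ _) (≈-sym (≈-trans
      (sum-single _ l λ k k≢l → reflexive
        (only-if-no (g k Fin.≟ g l) (k≢l ∘ g-inj k l)))
      (reflexive (only-if-yes (g l Fin.≟ g l) refl))))

  -- Only two edges move p: `edge p` to the next vertex and `edge (prev p)` to the previous one. The
  -- two missing terms `v p` are added on the left, which avoids a subtraction.
  cycle-sum : ∀ {n} (v : Vector Carrier (2 ℕ.+ n)) p →
    sum (λ k → v (edge k ⟨$⟩ʳ p)) + (v p + v p) ≈
    sum {2 ℕ.+ n} (λ _ → v p) + (v (next p) + v (prev p))
  cycle-sum {n} v p = begin
    sum (λ k → v (edge k ⟨$⟩ʳ p)) + (v p + v p)
      ≈⟨ correction (λ k → v (edge k ⟨$⟩ʳ p)) (v p) (v p) ⟨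
    sum (λ k → v (edge k ⟨$⟩ʳ p) + (here k (v p) + before k (v p)))
      ≈⟨ sum-cong-≋ (λ k → termwise k (p Fin.≟ k) (prev p Fin.≟ k)) ⟩
    sum (λ k → v p + (here k (v (next p)) + before k (v (prev p))))
      ≈⟨ correction (λ _ → v p) (v (next p)) (v (prev p)) ⟩
    sum {2 ℕ.+ n} (λ _ → v p) + (v (next p) + v (prev p)) ∎
    where
    here before : Fin (2 ℕ.+ n) → Carrier → Carrier
    here k x = only-if (p Fin.≟ k) x
    before k x = only-if (prev p Fin.≟ k) x
    correction : ∀ (w : Vector Carrier (2 ℕ.+ n)) x y →
      sum (λ k → w k + (here k x + before k y)) ≈ sum w + (x + y)
    correction w x y = ≈-trans (∑-distrib-+ w (λ k → here k x + before k y))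
      (+-congˡ (≈-trans (∑-distrib-+ (λ k → here k x) (λ k → before k y))
        (+-cong (sum-only-if p (λ _ → x)) (sum-only-if (prev p) (λ _ → y)))))
    swap-left : ∀ x y → x + (y + 0#) ≈ y + (x + 0#)
    swap-left x y = ≈-trans (+-congˡ (+-identityʳ y))
      (≈-trans (+-comm x y) (≈-sym (+-congˡ (+-identityʳ x))))
    swap-right : ∀ x y → x + (0# + y) ≈ y + (0# + x)
    swap-right x y = ≈-trans (+-congˡ (+-identityˡ y))
      (≈-trans (+-comm x y) (≈-sym (+-congˡ (+-identityˡ x))))
    termwise : ∀ k → Dec (p ≡ k) → Dec (prev p ≡ k) →
      v (edge k ⟨$⟩ʳ p) + (here k (v p) + before k (v p)) ≈
      v p + (here k (v (next p)) + before k (v (prev p)))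
    termwise k (yes p≡k) (yes prev≡k) = contradiction
      (trans (cong next (trans p≡k (sym prev≡k))) (next-prev p)) (next≢ p)
    termwise k (yes p≡k) (no prev≢k) = ≈-trans
      (+-cong (reflexive (cong v (edge-here p≡k)))
        (reflexive (cong₂ _+_ (only-if-yes (p Fin.≟ k) p≡k) (only-if-no (prev p Fin.≟ k) prev≢k))))
      (≈-trans (swap-left (v (next p)) (v p)) (+-congˡ (reflexive (sym
        (cong₂ _+_ (only-if-yes (p Fin.≟ k) p≡k) (only-if-no (prev p Fin.≟ k) prev≢k))))))
    termwise k (no p≢k) (yes prev≡k) = ≈-trans
      (+-cong (reflexive (cong v (edge-before {p = p} prev≡k)))
        (reflexive (cong₂ _+_ (only-if-no (p Fin.≟ k) p≢k) (only-if-yes (prev p Fin.≟ k) prev≡k))))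
      (≈-trans (swap-right (v (prev p)) (v p)) (+-congˡ (reflexive (sym
        (cong₂ _+_ (only-if-no (p Fin.≟ k) p≢k) (only-if-yes (prev p Fin.≟ k) prev≡k))))))
    termwise k (no p≢k) (no prev≢k) = +-cong
      (reflexive (cong v (edge-elsewhere {p = p} p≢k prev≢k)))
      (reflexive (trans
        (cong₂ _+_ (only-if-no (p Fin.≟ k) p≢k) (only-if-no (prev p Fin.≟ k) prev≢k))
        (sym (cong₂ _+_ (only-if-no (p Fin.≟ k) p≢k) (only-if-no (prev p Fin.≟ k) prev≢k)))))

  module Integers
    (ι : ℤ → Carrier)
    (ι-0 : ι 0ℤ ≈ 0#) (ι-1 : ι 1ℤ ≈ 1#)
    (ι-+ : ∀ y z → ι (y ℤ.+ z) ≈ ι y + ι z)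
    (ι-* : ∀ y z → ι (y ℤ.* z) ≈ ι y * ι z)
    (ι-neg : ∀ z → ι (ℤ.- z) ≈ - ι z)
    where

    factors : Carrier → List ℤ → Carrier → Carrier
    factors μ ks x = foldr (λ k y → (μ + - ι k) * y) x ks

    factors-shift : ∀ μ ks a x → a * factors μ ks x ≈ factors μ ks (a * x)
    factors-shift μ []       a x = ≈-refl
    factors-shift μ (k ∷ ks) a x = ≈-trans
      (x*yz≈y*xz a (μ + - ι k) (factors μ ks x)) (*-congˡ (factors-shift μ ks a x))

    factors-cong : ∀ {μ x y} ks → x ≈ y → factors μ ks x ≈ factors μ ks y
    factors-cong []       x≈y = x≈y
    factors-cong (k ∷ ks) x≈y = *-congˡ (factors-cong ks x≈y)

    Regular : Carrier → Set
    Regular a = ∀ {x} → a * x ≈ 0# → x ≈ 0#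

    factors-regular : ∀ {μ} ks → All (λ k → Regular (μ + - ι k)) ks →
                      ∀ {x} → factors μ ks x ≈ 0# → x ≈ 0#
    factors-regular []       []       x≈0 = x≈0
    factors-regular (k ∷ ks) (a ∷ as) x≈0 = factors-regular ks as (a x≈0)

    -- The head factor is moved inside next to x, and the remaining factors are then cancelled from
    -- the outside.
    factors-head : ∀ {μ} k ks → All (λ l → Regular (μ + - ι l)) ks →
                   ∀ {x} → factors μ (k ∷ ks) x ≈ 0# → (μ + - ι k) * x ≈ 0#
    factors-head {μ} k ks regular {x} fx≈0 = factors-regular ks regular
      (≈-trans (≈-sym (factors-shift μ ks (μ + - ι k) x)) fx≈0)

    ι-sum : ∀ {n} (f : Vector ℤ n) → ι (ℤ-sum f) ≈ sum (ι ∘ f)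
    ι-sum {zero}  f = ι-0
    ι-sum {suc n} f = ≈-trans (ι-+ _ _) (+-congˡ (ι-sum (f ∘ suc)))

    sum-const : ∀ n x → sum {n} (λ _ → x) ≈ ι (ℤ.+ n) * x
    sum-const zero    x = ≈-sym (≈-trans (*-congʳ ι-0) (zeroˡ x))
    sum-const (suc n) x = begin
      x + sum {n} (λ _ → x)        ≈⟨ +-cong (*-identityˡ x) (≈-sym (sum-const n x)) ⟨
      1# * x + ι (ℤ.+ n) * x       ≈⟨ distribʳ x 1# (ι (ℤ.+ n)) ⟨
      (1# + ι (ℤ.+ n)) * x         ≈⟨ *-congʳ (≈-trans (ι-+ 1ℤ (ℤ.+ n)) (+-congʳ ι-1)) ⟨
      ι (ℤ.+ suc n) * x            ∎

    ⟦_⟧ : ∀ {n} → Vec ℤ n → Vector Carrier n → Carrier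
    ⟦ c ⟧ u = sum λ j → ι (lookup c j) * u j

    module Rows {n r} (h : Fin r → Fin n → Fin n) (h-invol : ∀ k j → h k (h k j) ≡ j) where
      open RowReduction h

      -- The permutation matrix of an involution is symmetric: reindexing by `h k` moves it from one
      -- argument of the pairing to the other.
      transport : ∀ k (a u : Vector Carrier n) →
                  sum (λ j → a (h k j) * u j) ≈ sum (λ j → a j * u (h k j))
      transport k a u = begin
        sum (λ j → a (h k j) * u j)
          ≈⟨ sum-cong-≋ (λ j → *-congˡ (reflexive (cong u (sym (h-invol k j))))) ⟩
        sum (λ j → a (h k j) * u (h k (h k j)))
          ≈⟨ sum-permute (λ j → a j * u (h k j)) (permutation (h k) (h k) (h-invol k) (h-invol k)) ⟨
        sum (λ j → a j * u (h k j)) ∎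

      module _ {μ} (u : Vector Carrier n) (eigen : ∀ j → sum (λ k → u (h k j)) ≈ μ * u j) where

        adjoint : ∀ (a : Vector Carrier n) →
          sum (λ j → sum (λ k → a (h k j)) * u j) ≈ μ * sum (λ j → a j * u j)
        adjoint a = begin
          sum (λ j → sum (λ k → a (h k j)) * u j)  ≈⟨ sum-cong-≋ (λ j → *-distribʳ-sum (u j) (λ k → a (h k j))) ⟩
          sum (λ j → sum (λ k → a (h k j) * u j))  ≈⟨ ∑-comm (λ j k → a (h k j) * u j) ⟩
          sum (λ k → sum (λ j → a (h k j) * u j))  ≈⟨ sum-cong-≋ (λ k → transport k a u) ⟩
          sum (λ k → sum (λ j → a j * u (h k j)))  ≈⟨ ∑-comm (λ k j → a j * u (h k j)) ⟩
          sum (λ j → sum (λ k → a j * u (h k j)))  ≈⟨ sum-cong-≋ (λ j → *-distribˡ-sum (a j) (λ k → u (h k j))) ⟨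
          sum (λ j → a j * sum (λ k → u (h k j)))  ≈⟨ sum-cong-≋ (λ j → *-congˡ (eigen j)) ⟩
          sum (λ j → a j * (μ * u j))              ≈⟨ sum-cong-≋ (λ j → x*yz≈y*xz (a j) μ (u j)) ⟩
          sum (λ j → μ * (a j * u j))              ≈⟨ *-distribˡ-sum μ (λ j → a j * u j) ⟨
          μ * sum (λ j → a j * u j)                ∎

        step-eigen : ∀ κ c → ⟦ step κ c ⟧ u ≈ (μ + - ι κ) * ⟦ c ⟧ u
        step-eigen κ c = begin
          ⟦ step κ c ⟧ u
            ≈⟨ sum-cong-≋ coefficient ⟩
          sum (λ j → sum (λ k → a (h k j)) * u j + - ι κ * (a j * u j))
            ≈⟨ ∑-distrib-+ (λ j → sum (λ k → a (h k j)) * u j) (λ j → - ι κ * (a j * u j)) ⟩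
          sum (λ j → sum (λ k → a (h k j)) * u j) + sum (λ j → - ι κ * (a j * u j))
            ≈⟨ +-cong (adjoint a) (≈-sym (*-distribˡ-sum (- ι κ) (λ j → a j * u j))) ⟩
          μ * ⟦ c ⟧ u + - ι κ * ⟦ c ⟧ u
            ≈⟨ distribʳ (⟦ c ⟧ u) μ (- ι κ) ⟨
          (μ + - ι κ) * ⟦ c ⟧ u ∎
          where
          a : Vector Carrier n
          a j = ι (lookup c j)
          coefficient : ∀ j → ι (lookup (step κ c) j) * u j
            ≈ sum (λ k → a (h k j)) * u j + - ι κ * (a j * u j)
          coefficient j = begin
            ι (lookup (step κ c) j) * u j
              ≈⟨ *-congʳ (reflexive (cong ι (lookup∘tabulate _ j))) ⟩
            ι (ℤ-sum (λ k → lookup c (h k j)) ℤ.+ ℤ.- κ ℤ.* lookup c j) * u j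
              ≈⟨ *-congʳ (≈-trans (ι-+ _ _) (+-cong (ι-sum (λ k → lookup c (h k j)))
                   (≈-trans (ι-* (ℤ.- κ) (lookup c j)) (*-congʳ (ι-neg κ))))) ⟩
            (sum (λ k → a (h k j)) + - ι κ * a j) * u j
              ≈⟨ distribʳ (u j) _ _ ⟩
            sum (λ k → a (h k j)) * u j + (- ι κ * a j) * u j
              ≈⟨ +-congˡ (*-assoc (- ι κ) (a j) (u j)) ⟩
            sum (λ k → a (h k j)) * u j + - ι κ * (a j * u j) ∎

        run-eigen : ∀ ks c → ⟦ run ks c ⟧ u ≈ factors μ ks (⟦ c ⟧ u)
        run-eigen []       c = ≈-refl
        run-eigen (κ ∷ ks) c = ≈-trans (step-eigen κ (run ks c)) (*-congˡ (run-eigen ks c))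

        ⟦basis⟧ : ∀ i → ⟦ basis i ⟧ u ≈ u i
        ⟦basis⟧ i = ≈-trans (sum-cong-≋ entry) (sum-only-if i u)
          where
          entry : ∀ j → ι (lookup (basis i) j) * u j ≈ only-if (i Fin.≟ j) (u j)
          entry j rewrite lookup∘tabulate (λ j → if does (i Fin.≟ j) then 1ℤ else 0ℤ) j with does (i Fin.≟ j)
          ... | true  = ≈-trans (*-congʳ ι-1) (*-identityˡ (u j))
          ... | false = ≈-trans (*-congʳ ι-0) (zeroˡ (u j))

        -- Pairing a basis row with the eigenvector u reads off `u i`, and each factor B - κ acts on
        -- the pairing as μ - κ. A vanishing integer row thus becomes an equation for every
        -- eigenvalue in the ring.
        annihilated : ∀ ks i → run ks (basis i) ≡ Vec.replicate n 0ℤ →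
                      factors μ ks (u i) ≈ 0#
        annihilated ks i run≡0 = begin
          factors μ ks (u i)              ≈⟨ factors-cong ks (⟦basis⟧ i) ⟨
          factors μ ks (⟦ basis i ⟧ u)    ≈⟨ run-eigen ks (basis i) ⟨
          ⟦ run ks (basis i) ⟧ u          ≈⟨ reflexive (cong (λ c → ⟦ c ⟧ u) run≡0) ⟩
          ⟦ Vec.replicate n 0ℤ ⟧ u        ≈⟨ sum-zero _ (λ j → ≈-trans
            (*-congʳ (≈-trans (reflexive (cong ι (lookup-replicate j 0ℤ))) ι-0)) (zeroˡ (u j))) ⟩
          0#                              ∎

    -- After adding a second copy of 2 v(p) to `cycle-sum`, the hypothesis absorbs the two
    -- neighbours, and m v(p) splits as z v(p) + 4 v(p). Here z = m - 4 is an integer because it is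
    -- negative for small m. The application has D = x².
    cycle-eigen : ∀ {n} z → z ℤ.+ + 4 ≡ + (2 ℕ.+ n) → ∀ D (v : Vector Carrier (2 ℕ.+ n)) →
      (∀ p → (v (next p) + v (prev p)) + (v p + v p) ≈ D * v p) →
      ∀ p → sum (λ k → v (edge k ⟨$⟩ʳ p)) ≈ (ι z + D) * v p
    cycle-eigen {n} z z+4≡m D v recurrence p = ∙-cancelʳ (w + w) S ((ι z + D) * x) (begin
      S + (w + w)                      ≈⟨ +-assoc S w w ⟨
      (S + w) + w                      ≈⟨ +-congʳ (cycle-sum v p) ⟩
      (sum {2 ℕ.+ n} (λ _ → x) + ab) + w
                                       ≈⟨ +-assoc _ ab w ⟩
      sum {2 ℕ.+ n} (λ _ → x) + (ab + w)
                                       ≈⟨ +-cong (sum-const (2 ℕ.+ n) x) (recurrence p) ⟩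
      ι (+ (2 ℕ.+ n)) * x + D * x      ≈⟨ +-congʳ m-split ⟩
      (ι z * x + (w + w)) + D * x      ≈⟨ +-assoc _ _ _ ⟩
      ι z * x + ((w + w) + D * x)      ≈⟨ +-congˡ (+-comm _ _) ⟩
      ι z * x + (D * x + (w + w))      ≈⟨ +-assoc _ _ _ ⟨
      (ι z * x + D * x) + (w + w)      ≈⟨ +-congʳ (distribʳ x (ι z) D) ⟨
      (ι z + D) * x + (w + w)          ∎)
      where
      x = v p
      w = x + x
      ab = v (next p) + v (prev p)
      S = sum (λ k → v (edge k ⟨$⟩ʳ p))
      four : ι (+ 4) * x ≈ w + w
      four = begin
        ι (+ 4) * x                  ≈⟨ sum-const 4 x ⟨
        x + (x + (x + (x + 0#)))     ≈⟨ +-congˡ (+-congˡ (+-congˡ (+-identityʳ x))) ⟩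
        x + (x + (x + x))            ≈⟨ +-assoc x x w ⟨
        w + w                        ∎
      m-split : ι (+ (2 ℕ.+ n)) * x ≈ ι z * x + (w + w)
      m-split = begin
        ι (+ (2 ℕ.+ n)) * x      ≈⟨ *-congʳ (reflexive (cong ι z+4≡m)) ⟨
        ι (z ℤ.+ + 4) * x        ≈⟨ *-congʳ (ι-+ z (+ 4)) ⟩
        (ι z + ι (+ 4)) * x      ≈⟨ distribʳ x (ι z) (ι (+ 4)) ⟩
        ι z * x + ι (+ 4) * x    ≈⟨ +-congˡ four ⟩
        ι z * x + (w + w)        ∎

    ι-difference : ∀ y z {x} → ι y + x ≈ ι z → x ≈ ι (z ℤ.- y)
    ι-difference y z {x} eq = ∙-cancelʳ (ι y) x (ι (z ℤ.- y)) (begin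
      x + ι y                ≈⟨ +-comm x (ι y) ⟩
      ι y + x                ≈⟨ eq ⟩
      ι z                    ≈⟨ reflexive (cong ι (sym (i-j+j≡i z y))) ⟩
      ι ((z ℤ.- y) ℤ.+ y)    ≈⟨ ι-+ (z ℤ.- y) y ⟩
      ι (z ℤ.- y) + ι y      ∎)

    quadratic-root : ∀ {μ} → (μ * μ + - (μ + μ)) + - ι (+ 4) ≈ 0# → μ * μ ≈ ι (+ 4) + ι (+ 2) * μ
    quadratic-root {μ} root = begin
      μ * μ                                    ≈⟨ +-identityʳ (μ * μ) ⟨
      μ * μ + 0#                               ≈⟨ +-congˡ (-‿inverseˡ (μ + μ)) ⟨
      μ * μ + (- (μ + μ) + (μ + μ))            ≈⟨ +-assoc _ _ _ ⟨
      (μ * μ + - (μ + μ)) + (μ + μ)            ≈⟨ +-cong (inverseˡ-unique′ root) double-μ ⟩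
      ι (+ 4) + ι (+ 2) * μ                    ∎
      where
      inverseˡ-unique′ : ∀ {x y} → x + - y ≈ 0# → x ≈ y
      inverseˡ-unique′ {x} {y} eq = ∙-cancelʳ (- y) x y (≈-trans eq (≈-sym (-‿inverseʳ y)))
      double-μ : μ + μ ≈ ι (+ 2) * μ
      double-μ = ≈-trans (+-congˡ (≈-sym (+-identityʳ μ))) (sum-const 2 μ)

    -- Multiplication by μ in the basis 1, μ, where μ² = 4 + 2μ, sends a + bμ to 4b + (a + 2b)μ. The
    -- eigenvector equation is thereby reduced to two identities between integers.
    quadratic-eigen : ∀ {μ} → μ * μ ≈ ι (+ 4) + ι (+ 2) * μ →
      ∀ {r} (α β : Vector ℤ r) a b → ℤ-sum α ≡ b ℤ.* + 4 → ℤ-sum β ≡ a ℤ.+ b ℤ.* + 2 →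
      sum (λ k → ι (α k) + ι (β k) * μ) ≈ μ * (ι a + ι b * μ)
    quadratic-eigen {μ} μ² α β a b Σα Σβ = begin
      sum (λ k → ι (α k) + ι (β k) * μ)
        ≈⟨ ∑-distrib-+ (λ k → ι (α k)) (λ k → ι (β k) * μ) ⟩
      sum (λ k → ι (α k)) + sum (λ k → ι (β k) * μ)
        ≈⟨ +-cong (ι-sum α) (*-distribʳ-sum μ (λ k → ι (β k))) ⟨
      ι (ℤ-sum α) + sum (λ k → ι (β k)) * μ
        ≈⟨ +-congˡ (*-congʳ (ι-sum β)) ⟨
      ι (ℤ-sum α) + ι (ℤ-sum β) * μ
        ≈⟨ +-cong (reflexive (cong ι Σα)) (*-congʳ (reflexive (cong ι Σβ))) ⟩
      ι (b ℤ.* + 4) + ι (a ℤ.+ b ℤ.* + 2) * μ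
        ≈⟨ +-cong (ι-* b (+ 4)) (*-congʳ (≈-trans (ι-+ a (b ℤ.* + 2)) (+-congˡ (ι-* b (+ 2))))) ⟩
      ι b * ι (+ 4) + (ι a + ι b * ι (+ 2)) * μ
        ≈⟨ +-congˡ (distribʳ μ (ι a) (ι b * ι (+ 2))) ⟩
      ι b * ι (+ 4) + (ι a * μ + (ι b * ι (+ 2)) * μ)
        ≈⟨ x+yz≈y+xz _ _ _ ⟩
      ι a * μ + (ι b * ι (+ 4) + (ι b * ι (+ 2)) * μ)
        ≈⟨ +-congˡ (+-congˡ (*-assoc (ι b) (ι (+ 2)) μ)) ⟩
      ι a * μ + (ι b * ι (+ 4) + ι b * (ι (+ 2) * μ))
        ≈⟨ +-congˡ (distribˡ (ι b) (ι (+ 4)) (ι (+ 2) * μ)) ⟨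
      ι a * μ + ι b * (ι (+ 4) + ι (+ 2) * μ)
        ≈⟨ +-congˡ (*-congˡ μ²) ⟨
      ι a * μ + ι b * (μ * μ)
        ≈⟨ +-congˡ (*-assoc (ι b) μ μ) ⟨
      ι a * μ + (ι b * μ) * μ
        ≈⟨ distribʳ μ (ι a) (ι b * μ) ⟨
      (ι a + ι b * μ) * μ
        ≈⟨ *-comm _ μ ⟩
      μ * (ι a + ι b * μ) ∎

-- The reals as a commutative ring

<⇒≱ : ∀ {p q} → p ℚ.< q → ¬ (q ℚ.≤ p)
<⇒≱ p<q q≤p = ℚ.<-irrefl refl (ℚ.<-≤-trans p<q q≤p)

p≤∣p∣ : ∀ p → p ℚ.≤ ∣ p ∣
p≤∣p∣ p with ℚ.≤-total 0ℚ p
... | inj₁ 0≤p = ℚ.≤-reflexive (sym (ℚ.0≤p⇒∣p∣≡p 0≤p))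
... | inj₂ p≤0 = ℚ.≤-trans p≤0 (ℚ.0≤∣p∣ p)

∣p∣<ε : ∀ {p ε} → p ℚ.< ε → ℚ.- p ℚ.< ε → ∣ p ∣ ℚ.< ε
∣p∣<ε {p} {ε} p< -p< with ℚ.∣p∣≡p∨∣p∣≡-p p
... | inj₁ eq = subst (ℚ._< ε) (sym eq) p<
... | inj₂ eq = subst (ℚ._< ε) (sym eq) -p<

∣p-q∣≡∣q-p∣ : ∀ p q → ∣ p ℚ.- q ∣ ≡ ∣ q ℚ.- p ∣
∣p-q∣≡∣q-p∣ p q = trans (sym (ℚ.∣-p∣≡∣p∣ (p ℚ.- q)))
  (cong ∣_∣ (solve 2 (λ p q → :- (p :- q) := q :- p) refl p q))

≤-from-difference : ∀ {p q d} → 0ℚ ℚ.≤ d → q ≡ p ℚ.+ d → p ℚ.≤ q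
≤-from-difference {p} {q} {d} 0≤d q≡p+d = begin
  p           ≡⟨ ℚ.+-identityʳ p ⟨
  p ℚ.+ 0ℚ    ≤⟨ ℚ.+-monoʳ-≤ p 0≤d ⟩
  p ℚ.+ d     ≡⟨ q≡p+d ⟨
  q           ∎
  where open ℚ.≤-Reasoning

p≤q⇒0≤q-p : ∀ {p q} → p ℚ.≤ q → 0ℚ ℚ.≤ q ℚ.- p
p≤q⇒0≤q-p {p} {q} p≤q =
  subst (ℚ._≤ q ℚ.- p) (ℚ.+-inverseʳ p) (ℚ.+-monoˡ-≤ (ℚ.- p) p≤q)

p<q⇒0<q-p : ∀ {p q} → p ℚ.< q → 0ℚ ℚ.< q ℚ.- p
p<q⇒0<q-p {p} {q} p<q =
  subst (ℚ._< q ℚ.- p) (ℚ.+-inverseʳ p) (ℚ.+-monoˡ-< (ℚ.- p) p<q)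

0≤p*q : ∀ {p q} → 0ℚ ℚ.≤ p → 0ℚ ℚ.≤ q → 0ℚ ℚ.≤ p ℚ.* q
0≤p*q {p} {q} 0≤p 0≤q = ℚ.nonNegative⁻¹ _
  {{ℚ.nonNeg*nonNeg⇒nonNeg p {{ℚ.nonNegative 0≤p}} q {{ℚ.nonNegative 0≤q}}}}

0<p*q : ∀ {p q} → 0ℚ ℚ.< p → 0ℚ ℚ.< q → 0ℚ ℚ.< p ℚ.* q
0<p*q {p} {q} 0<p 0<q = ℚ.positive⁻¹ _
  {{ℚ.pos*pos⇒pos p {{ℚ.positive 0<p}} q {{ℚ.positive 0<q}}}}

triangle : ∀ p q r → (p ℚ.- q) ℚ.+ (q ℚ.- r) ≡ p ℚ.- r
triangle = solve 3 (λ p q r → (p :- q) :+ (q :- r) := p :- r) refl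

p+p≡2p : ∀ p → p ℚ.+ p ≡ (1ℚ ℚ.+ 1ℚ) ℚ.* p
p+p≡2p = solve 1 (λ p → p :+ p := con (1ℚ ℚ.+ 1ℚ) :* p) refl

opaque
  halve : ∀ ε → 0ℚ ℚ.< ε → ∃ λ δ → 0ℚ ℚ.< δ × δ ℚ.+ δ ≡ ε
  halve ε 0<ε =
    let δ , 0<δ , 2δ≡ε = quotient (1ℚ ℚ.+ 1ℚ) _ ε 0<ε
    in δ , 0<δ , trans (p+p≡2p δ) 2δ≡ε

-- A record, unlike _≈ᵣ_ itself, lets Agda infer the two sides of an equation.
infix 4 _≃_
record _≃_ (x y : ℝ) : Set where
  constructor ⟪_⟫
  field limit : x ≈ᵣ y

open _≃_

pointwise : ∀ {x y} → (∀ n → seq x n ≡ seq y n) → x ≃ y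
pointwise {x} {y} eq .limit ε 0<ε = 0 , λ n _ →
  subst (ℚ._< ε)
    (cong ∣_∣ (sym (trans (cong (ℚ._- seq y n) (eq n)) (ℚ.+-inverseʳ (seq y n)))))
    0<ε

≃-sym : ∀ {x y} → x ≃ y → y ≃ x
≃-sym {x} {y} ⟪ x≈y ⟫ .limit ε 0<ε with x≈y ε 0<ε
... | N , close = N , λ n N≤n →
  subst (ℚ._< ε) (∣p-q∣≡∣q-p∣ (seq x n) (seq y n)) (close n N≤n)

≃-trans : ∀ {x y z} → x ≃ y → y ≃ z → x ≃ z
≃-trans {x} {y} {z} ⟪ x≈y ⟫ ⟪ y≈z ⟫ .limit ε 0<ε with halve ε 0<ε
... | δ , 0<δ , δ+δ≡ε with x≈y δ 0<δ | y≈z δ 0<δ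
... | M , xy | N , yz = M ℕ.⊔ N , λ n ≤n → begin-strict
  ∣ seq x n ℚ.- seq z n ∣
    ≡⟨ cong ∣_∣ (sym (triangle (seq x n) (seq y n) (seq z n))) ⟩
  ∣ (seq x n ℚ.- seq y n) ℚ.+ (seq y n ℚ.- seq z n) ∣
    ≤⟨ ℚ.∣p+q∣≤∣p∣+∣q∣ (seq x n ℚ.- seq y n) (seq y n ℚ.- seq z n) ⟩
  ∣ seq x n ℚ.- seq y n ∣ ℚ.+ ∣ seq y n ℚ.- seq z n ∣
    <⟨ ℚ.+-mono-< (xy n (ℕ.m⊔n≤o⇒m≤o M N ≤n)) (yz n (ℕ.m⊔n≤o⇒n≤o M N ≤n)) ⟩
  δ ℚ.+ δ
    ≡⟨ δ+δ≡ε ⟩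
  ε ∎
  where open ℚ.≤-Reasoning

+ᵣ-cong : ∀ {x x′ y y′} → x ≃ x′ → y ≃ y′ → x +ᵣ y ≃ x′ +ᵣ y′
+ᵣ-cong {x} {x′} {y} {y′} ⟪ x≈ ⟫ ⟪ y≈ ⟫ .limit ε 0<ε with halve ε 0<ε
... | δ , 0<δ , δ+δ≡ε with x≈ δ 0<δ | y≈ δ 0<δ
... | M , xx′ | N , yy′ = M ℕ.⊔ N , λ n ≤n → begin-strict
  ∣ (seq x n ℚ.+ seq y n) ℚ.- (seq x′ n ℚ.+ seq y′ n) ∣
    ≡⟨ cong ∣_∣ (+-diff (seq x n) (seq y n) (seq x′ n) (seq y′ n)) ⟩
  ∣ (seq x n ℚ.- seq x′ n) ℚ.+ (seq y n ℚ.- seq y′ n) ∣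
    ≤⟨ ℚ.∣p+q∣≤∣p∣+∣q∣ (seq x n ℚ.- seq x′ n) (seq y n ℚ.- seq y′ n) ⟩
  ∣ seq x n ℚ.- seq x′ n ∣ ℚ.+ ∣ seq y n ℚ.- seq y′ n ∣
    <⟨ ℚ.+-mono-< (xx′ n (ℕ.m⊔n≤o⇒m≤o M N ≤n)) (yy′ n (ℕ.m⊔n≤o⇒n≤o M N ≤n)) ⟩
  δ ℚ.+ δ
    ≡⟨ δ+δ≡ε ⟩
  ε ∎
  where open ℚ.≤-Reasoning

*ᵣ-cong : ∀ {x x′ y y′} → x ≃ x′ → y ≃ y′ → x *ᵣ y ≃ x′ *ᵣ y′
*ᵣ-cong {x} {x′} {y} {y′} ⟪ x≈ ⟫ ⟪ y≈ ⟫ .limit ε 0<ε =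
  let B , K , B>0 , x≤B  = eventually-bounded (seq x) (cauchy x)
      C , L , C>0 , y′≤C = eventually-bounded (seq y′) (cauchy y′)
      δ , 0<δ , [B+C]δ≡ε =
        quotient (B ℚ.+ C) (ℚ.pos+pos⇒pos B {{B>0}} C {{C>0}}) ε 0<ε
      M , x-close = x≈ δ 0<δ
      N , y-close = y≈ δ 0<δ
  in (K ℕ.⊔ L) ℕ.⊔ (M ℕ.⊔ N) , λ n ≤n →
    let KL≤n = ℕ.m⊔n≤o⇒m≤o (K ℕ.⊔ L) (M ℕ.⊔ N) ≤n
        MN≤n = ℕ.m⊔n≤o⇒n≤o (K ℕ.⊔ L) (M ℕ.⊔ N) ≤n
    in subst (∣ seq x n ℚ.* seq y n ℚ.- seq x′ n ℚ.* seq y′ n ∣ ℚ.<_) [B+C]δ≡ε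
         (*-close B C B>0 C>0 (seq x n) (seq y n) (seq x′ n) (seq y′ n)
           (x≤B n (ℕ.m⊔n≤o⇒m≤o K L KL≤n))
           (y′≤C n (ℕ.m⊔n≤o⇒n≤o K L KL≤n))
           (x-close n (ℕ.m⊔n≤o⇒m≤o M N MN≤n))
           (y-close n (ℕ.m⊔n≤o⇒n≤o M N MN≤n)))

infix 8 -ᵣ_
-ᵣ_ : ℝ → ℝ
-ᵣ x = mkℝ (λ n → ℚ.- seq x n) λ ε 0<ε →
  let N , close = cauchy x ε 0<ε
  in N , λ m n N≤m N≤n → subst (ℚ._< ε)
       (trans (sym (ℚ.∣-p∣≡∣p∣ _))
              (cong ∣_∣ (ℚ.neg-distrib-+ (seq x m) (ℚ.- seq x n))))
       (close m n N≤m N≤n)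

-ᵣ-cong : ∀ {x y} → x ≃ y → -ᵣ x ≃ -ᵣ y
-ᵣ-cong {x} {y} ⟪ x≈y ⟫ .limit ε 0<ε =
  let N , close = x≈y ε 0<ε
  in N , λ n N≤n → subst (ℚ._< ε)
       (trans (sym (ℚ.∣-p∣≡∣p∣ _))
              (cong ∣_∣ (ℚ.neg-distrib-+ (seq x n) (ℚ.- seq y n))))
       (close n N≤n)

-- Comparing unfolded sums and products would make Agda compare the proofs that
-- they are Cauchy, so the ring operations are opaque copies of those of Defs.
infixl 6 _⊕_ _⊝_
infixl 7 _⊗_
infix 8 ⊖_

opaque
  _⊕_ _⊗_ : ℝ → ℝ → ℝ
  _⊕_ = _+ᵣ_
  _⊗_ = _*ᵣ_

  ⊖_ : ℝ → ℝ
  ⊖_ = -ᵣ_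

  ⊕-def : ∀ x y → x ⊕ y ≡ x +ᵣ y
  ⊕-def _ _ = refl

  ⊗-def : ∀ x y → x ⊗ y ≡ x *ᵣ y
  ⊗-def _ _ = refl

  seq-⊕ : ∀ x y n → seq (x ⊕ y) n ≡ seq x n ℚ.+ seq y n
  seq-⊕ _ _ _ = refl

  seq-⊗ : ∀ x y n → seq (x ⊗ y) n ≡ seq x n ℚ.* seq y n
  seq-⊗ _ _ _ = refl

  seq-⊖ : ∀ x n → seq (⊖ x) n ≡ ℚ.- seq x n
  seq-⊖ _ _ = refl

  ⊕-⊗-isCommutativeRing : IsCommutativeRing _≃_ _⊕_ _⊗_ ⊖_ 0ᵣ 1ᵣ
  ⊕-⊗-isCommutativeRing = record
    { isRing = record
      { +-isAbelianGroup = record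
        { isGroup = record
          { isMonoid = record
            { isSemigroup = record
              { isMagma = record
                { isEquivalence = record
                  { refl  = pointwise λ _ → refl
                  ; sym   = ≃-sym
                  ; trans = ≃-trans
                  }
                ; ∙-cong = +ᵣ-cong
                }
              ; assoc = λ x y z → pointwise λ n →
                  ℚ.+-assoc (seq x n) (seq y n) (seq z n)
              }
            ; identity = (λ x → pointwise λ n → ℚ.+-identityˡ (seq x n))
                       , (λ x → pointwise λ n → ℚ.+-identityʳ (seq x n))
            }
          ; inverse = (λ x → pointwise λ n → ℚ.+-inverseˡ (seq x n))
                    , (λ x → pointwise λ n → ℚ.+-inverseʳ (seq x n))
          ; ⁻¹-cong = -ᵣ-cong
          }
        ; comm = λ x y → pointwise λ n → ℚ.+-comm (seq x n) (seq y n)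
        }
      ; *-cong = *ᵣ-cong
      ; *-assoc = λ x y z → pointwise λ n →
          ℚ.*-assoc (seq x n) (seq y n) (seq z n)
      ; *-identity = (λ x → pointwise λ n → ℚ.*-identityˡ (seq x n))
                   , (λ x → pointwise λ n → ℚ.*-identityʳ (seq x n))
      ; distrib = (λ x y z → pointwise λ n →
                    ℚ.*-distribˡ-+ (seq x n) (seq y n) (seq z n))
                , (λ x y z → pointwise λ n →
                    ℚ.*-distribʳ-+ (seq x n) (seq y n) (seq z n))
      }
    ; *-comm = λ x y → pointwise λ n → ℚ.*-comm (seq x n) (seq y n)
    }

ℝ-commutativeRing : CommutativeRing 0ℓ 0ℓ
ℝ-commutativeRing = record { isCommutativeRing = ⊕-⊗-isCommutativeRing }

_⊝_ : ℝ → ℝ → ℝ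
x ⊝ y = x ⊕ ⊖ y

seq-⊝ : ∀ x y n → seq (x ⊝ y) n ≡ seq x n ℚ.- seq y n
seq-⊝ x y n = trans (seq-⊕ x (⊖ y) n) (cong (seq x n ℚ.+_) (seq-⊖ y n))

-- The quotient on the left is normalised by a gcd that does not reduce for a variable z; the
-- right-hand side has denominator 1 by definition, so arithmetic on it computes.
/1≡fromℤ : ∀ z → z ℚ./ 1 ≡ Literals.fromℤ z
/1≡fromℤ z = ℚ.↥p/↧p≡p (Literals.fromℤ z)

/1-homo-+ : ∀ y z → (y ℤ.+ z) ℚ./ 1 ≡ y ℚ./ 1 ℚ.+ z ℚ./ 1
/1-homo-+ y z rewrite /1≡fromℤ y | /1≡fromℤ z =
  sym (cong (ℚ._/ 1) (cong₂ ℤ._+_ (ℤ.*-identityʳ y) (ℤ.*-identityʳ z)))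

/1-homo-* : ∀ y z → (y ℤ.* z) ℚ./ 1 ≡ y ℚ./ 1 ℚ.* (z ℚ./ 1)
/1-homo-* y z rewrite /1≡fromℤ y | /1≡fromℤ z = refl

/1-homo‿- : ∀ z → (ℤ.- z) ℚ./ 1 ≡ ℚ.- (z ℚ./ 1)
/1-homo‿- z = trans (sym (cong (ℚ._/ 1) (ℤ.-1*i≡-i z)))
  (trans (/1-homo-* (ℤ.- + 1) z)
    (trans (sym (ℚ.neg-distribˡ-* 1ℚ (z ℚ./ 1))) (cong ℚ.-_ (ℚ.*-identityˡ (z ℚ./ 1)))))

/1-mono-≤ : ∀ {y z} → y ℤ.≤ z → y ℚ./ 1 ℚ.≤ z ℚ./ 1
/1-mono-≤ {y} {z} y≤z rewrite /1≡fromℤ y | /1≡fromℤ z =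
  ℚ.*≤* (ℤ.*-monoʳ-≤-nonNeg (+ 1) y≤z)

between-integers : ∀ x z₀ {a b} → z₀ ℚ./ 1 ℚ.< a → b ℚ.< (z₀ ℤ.+ + 1) ℚ./ 1 →
  (∀ n → a ℚ.≤ seq x n × seq x n ℚ.≤ b) → ∀ z → ¬ (x ≃ fromℤ z)
between-integers x z₀ {a} {b} z₀<a b<z₀+1 bounds z ⟪ x≈z ⟫ with z ℤ.≤? z₀
... | yes z≤z₀ = <⇒≱ (close N ℕ.≤-refl) (begin
  a ℚ.- z₀ ℚ./ 1             ≤⟨ ℚ.+-mono-≤ (proj₁ (bounds N)) (ℚ.neg-antimono-≤ (/1-mono-≤ z≤z₀)) ⟩
  seq x N ℚ.- z ℚ./ 1        ≤⟨ p≤∣p∣ _ ⟩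
  ∣ seq x N ℚ.- z ℚ./ 1 ∣    ∎)
  where
  open ℚ.≤-Reasoning
  near = x≈z (a ℚ.- z₀ ℚ./ 1) (p<q⇒0<q-p z₀<a)
  N = proj₁ near
  close = proj₂ near
... | no z≰z₀ = <⇒≱ (close N ℕ.≤-refl) (begin
  z₁ ℚ.- b                   ≤⟨ ℚ.+-mono-≤ (/1-mono-≤ z₁≤z) (ℚ.neg-antimono-≤ (proj₂ (bounds N))) ⟩
  z ℚ./ 1 ℚ.- seq x N        ≤⟨ p≤∣p∣ _ ⟩
  ∣ z ℚ./ 1 ℚ.- seq x N ∣    ≡⟨ ∣p-q∣≡∣q-p∣ (z ℚ./ 1) (seq x N) ⟩
  ∣ seq x N ℚ.- z ℚ./ 1 ∣    ∎)
  where
  open ℚ.≤-Reasoning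
  z₁ = (z₀ ℤ.+ + 1) ℚ./ 1
  z₁≤z : z₀ ℤ.+ + 1 ℤ.≤ z
  z₁≤z = subst (ℤ._≤ z) (ℤ.+-comm (+ 1) z₀) (ℤ.i<j⇒suc[i]≤j (ℤ.≰⇒> z≰z₀))
  near = x≈z (z₁ ℚ.- b) (p<q⇒0<q-p b<z₀+1)
  N = proj₁ near
  close = proj₂ near

module ℝ-Ring = CommutativeRing ℝ-commutativeRing
open RingLemmas ℝ-commutativeRing using (sum; sum-cong-≗; sum-over-image; module Integers)

-- Apartness from zero, and integer roots of a vanishing product

Small : ℚ → ℝ → Set
Small ε x = ∃ λ N → ∀ n → N ℕ.≤ n → ∣ seq x n ∣ ℚ.< ε

Apart₀ : ℝ → Set
Apart₀ x = ∃₂ λ δ N → 0ℚ ℚ.< δ × (∀ n → N ℕ.≤ n → δ ℚ.≤ ∣ seq x n ∣)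

p+q-q≡p : ∀ p q → (p ℚ.+ q) ℚ.- q ≡ p
p+q-q≡p = solve 2 (λ p q → (p :+ q) :- q := p) refl

p≤q+r⇒p-r≤q : ∀ {p q r} → p ℚ.≤ q ℚ.+ r → p ℚ.- r ℚ.≤ q
p≤q+r⇒p-r≤q {p} {q} {r} p≤q+r = begin
  p ℚ.- r            ≤⟨ ℚ.+-monoˡ-≤ (ℚ.- r) p≤q+r ⟩
  (q ℚ.+ r) ℚ.- r    ≡⟨ p+q-q≡p q r ⟩
  q                  ∎
  where open ℚ.≤-Reasoning

∣p∣≤∣p-q∣+∣q∣ : ∀ p q → ∣ p ∣ ℚ.≤ ∣ p ℚ.- q ∣ ℚ.+ ∣ q ∣
∣p∣≤∣p-q∣+∣q∣ p q = ℚ.≤-trans (ℚ.≤-reflexive (cong ∣_∣ (split p q)))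
  (ℚ.∣p+q∣≤∣p∣+∣q∣ (p ℚ.- q) q)

p+2p≡3p : ∀ p → p ℚ.+ (p ℚ.+ p) ≡ (1ℚ ℚ.+ (1ℚ ℚ.+ 1ℚ)) ℚ.* p
p+2p≡3p = solve 1 (λ p → p :+ (p :+ p) := con (1ℚ ℚ.+ (1ℚ ℚ.+ 1ℚ)) :* p) refl

opaque
  third : ∀ ε → 0ℚ ℚ.< ε → ∃ λ δ → 0ℚ ℚ.< δ × δ ℚ.+ (δ ℚ.+ δ) ≡ ε
  third ε 0<ε =
    let δ , 0<δ , 3δ≡ε = quotient (1ℚ ℚ.+ (1ℚ ℚ.+ 1ℚ)) _ ε 0<ε
    in δ , 0<δ , trans (p+2p≡3p δ) 3δ≡ε

-- Whether x vanishes is undecidable, but a comparison with tolerance is not. With γ = ε/3, past N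
-- all terms differ by less than γ, so one rational comparison of |x N| with 2γ shows that all later
-- terms are below 3γ or all are at least γ in absolute value.
small⊎apart : ∀ ε → 0ℚ ℚ.< ε → ∀ x → Small ε x ⊎ Apart₀ x
small⊎apart ε 0<ε x = decide (∣ seq x N ∣ ℚ.<? γ ℚ.+ γ)
  where
  open ℚ.≤-Reasoning
  γ = proj₁ (third ε 0<ε)
  0<γ = proj₁ (proj₂ (third ε 0<ε))
  near = cauchy x γ 0<γ
  N = proj₁ near
  decide : Dec (∣ seq x N ∣ ℚ.< γ ℚ.+ γ) → Small ε x ⊎ Apart₀ x
  decide (yes small) = inj₁ (N , λ n N≤n → begin-strict
    ∣ seq x n ∣
      ≤⟨ ∣p∣≤∣p-q∣+∣q∣ (seq x n) (seq x N) ⟩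
    ∣ seq x n ℚ.- seq x N ∣ ℚ.+ ∣ seq x N ∣
      <⟨ ℚ.+-mono-< (proj₂ near n N N≤n ℕ.≤-refl) small ⟩
    γ ℚ.+ (γ ℚ.+ γ)
      ≡⟨ proj₂ (proj₂ (third ε 0<ε)) ⟩
    ε ∎)
  decide (no large) = inj₂ (γ , N , 0<γ , λ n N≤n → begin
    γ
      ≡⟨ p+q-q≡p γ γ ⟨
    (γ ℚ.+ γ) ℚ.- γ
      ≤⟨ p≤q+r⇒p-r≤q (begin
        γ ℚ.+ γ                                  ≤⟨ ℚ.≮⇒≥ large ⟩
        ∣ seq x N ∣                              ≤⟨ ∣p∣≤∣p-q∣+∣q∣ (seq x N) (seq x n) ⟩
        ∣ seq x N ℚ.- seq x n ∣ ℚ.+ ∣ seq x n ∣  ≤⟨ ℚ.+-monoˡ-≤ ∣ seq x n ∣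
                                                    (ℚ.<⇒≤ (proj₂ near N n ℕ.≤-refl N≤n)) ⟩
        γ ℚ.+ ∣ seq x n ∣                        ≡⟨ ℚ.+-comm γ _ ⟩
        ∣ seq x n ∣ ℚ.+ γ                        ∎) ⟩
    ∣ seq x n ∣ ∎)

*-cancel-apart : ∀ x {y} → Apart₀ x → x ⊗ y ≃ 0ᵣ → y ≃ 0ᵣ
*-cancel-apart x {y} (δ , M , 0<δ , apart) ⟪ xy≈0 ⟫ .limit ε 0<ε =
  M ℕ.⊔ N , λ n ≤n → ℚ.*-cancelˡ-<-nonNeg δ {{ℚ.nonNegative (ℚ.<⇒≤ 0<δ)}} (begin-strict
    δ ℚ.* ∣ seq y n ℚ.- 0ℚ ∣
      ≡⟨ cong (λ p → δ ℚ.* ∣ p ∣) (ℚ.+-identityʳ (seq y n)) ⟩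
    δ ℚ.* ∣ seq y n ∣
      ≤⟨ ℚ.*-monoʳ-≤-nonNeg ∣ seq y n ∣ {{ℚ.∣-∣-nonNeg (seq y n)}}
           (apart n (ℕ.m⊔n≤o⇒m≤o M N ≤n)) ⟩
    ∣ seq x n ∣ ℚ.* ∣ seq y n ∣
      ≡⟨ ℚ.∣p*q∣≡∣p∣*∣q∣ (seq x n) (seq y n) ⟨
    ∣ seq x n ℚ.* seq y n ∣
      ≡⟨ cong ∣_∣ (sym (seq-⊗ x y n)) ⟩
    ∣ seq (x ⊗ y) n ∣
      ≡⟨ cong ∣_∣ (ℚ.+-identityʳ (seq (x ⊗ y) n)) ⟨
    ∣ seq (x ⊗ y) n ℚ.- 0ℚ ∣
      <⟨ proj₂ near n (ℕ.m⊔n≤o⇒n≤o M N ≤n) ⟩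
    δ ℚ.* ε ∎)
  where
  open ℚ.≤-Reasoning
  near = xy≈0 (δ ℚ.* ε) (0<p*q 0<δ 0<ε)
  N = proj₁ near

Separated : ℤ → ℤ → Set
Separated k l = 1ℚ ℚ.≤ ∣ k ℚ./ 1 ℚ.- l ℚ./ 1 ∣

swap-diff : ∀ m p q → (m ℚ.- p) ℚ.- (m ℚ.- q) ≡ q ℚ.- p
swap-diff = solve 3 (λ m p q → (m :- p) :- (m :- q) := q :- p) refl

separated⇒apart : ∀ {δ μ k l} → 0ℚ ℚ.< δ → δ ℚ.+ δ ≡ 1ℚ → Separated k l →
                  Small δ (μ ⊝ fromℤ k) → Apart₀ (μ ⊝ fromℤ l)
separated⇒apart {δ} {μ} {k} {l} 0<δ δ+δ≡1 sep (N , small) = δ , N , 0<δ , λ n N≤n →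
  subst (λ p → δ ℚ.≤ ∣ p ∣) (sym (seq-⊝ μ (fromℤ l) n))
    (bound (seq μ n) (k ℚ./ 1) (l ℚ./ 1) sep
      (subst (λ p → ∣ p ∣ ℚ.< δ) (seq-⊝ μ (fromℤ k) n) (small n N≤n)))
  where
  open ℚ.≤-Reasoning
  bound : ∀ m p q → 1ℚ ℚ.≤ ∣ p ℚ.- q ∣ → ∣ m ℚ.- p ∣ ℚ.< δ → δ ℚ.≤ ∣ m ℚ.- q ∣
  bound m p q 1≤∣p-q∣ ∣m-p∣<δ = begin
    δ                     ≡⟨ p+q-q≡p δ δ ⟨
    (δ ℚ.+ δ) ℚ.- δ       ≤⟨ p≤q+r⇒p-r≤q (begin
      δ ℚ.+ δ                        ≡⟨ δ+δ≡1 ⟩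
      1ℚ                             ≤⟨ 1≤∣p-q∣ ⟩
      ∣ p ℚ.- q ∣                    ≡⟨ ∣p-q∣≡∣q-p∣ p q ⟩
      ∣ q ℚ.- p ∣                    ≡⟨ cong ∣_∣ (sym (swap-diff m p q)) ⟩
      ∣ (m ℚ.- p) ℚ.- (m ℚ.- q) ∣    ≤⟨ ℚ.∣p-q∣≤∣p∣+∣q∣ (m ℚ.- p) (m ℚ.- q) ⟩
      ∣ m ℚ.- p ∣ ℚ.+ ∣ m ℚ.- q ∣    ≤⟨ ℚ.+-monoˡ-≤ ∣ m ℚ.- q ∣ (ℚ.<⇒≤ ∣m-p∣<δ) ⟩
      δ ℚ.+ ∣ m ℚ.- q ∣              ≡⟨ ℚ.+-comm δ ∣ m ℚ.- q ∣ ⟩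
      ∣ m ℚ.- q ∣ ℚ.+ δ              ∎) ⟩
    ∣ m ℚ.- q ∣           ∎

fromℤ-homo-+ : ∀ y z → fromℤ (y ℤ.+ z) ≃ fromℤ y ⊕ fromℤ z
fromℤ-homo-+ y z = pointwise λ n →
  trans (/1-homo-+ y z) (sym (seq-⊕ (fromℤ y) (fromℤ z) n))

fromℤ-homo-* : ∀ y z → fromℤ (y ℤ.* z) ≃ fromℤ y ⊗ fromℤ z
fromℤ-homo-* y z = pointwise λ n →
  trans (/1-homo-* y z) (sym (seq-⊗ (fromℤ y) (fromℤ z) n))

fromℤ-homo‿- : ∀ z → fromℤ (ℤ.- z) ≃ ⊖ fromℤ z
fromℤ-homo‿- z = pointwise λ n → trans (/1-homo‿- z) (sym (seq-⊖ (fromℤ z) n))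

module ℝ-Integers = Integers fromℤ ℝ-Ring.refl ℝ-Ring.refl
  fromℤ-homo-+ fromℤ-homo-* fromℤ-homo‿-
open ℝ-Integers using (factors; factors-head; Regular; module Rows;
  cycle-eigen; ι-difference; quadratic-root; quadratic-eigen)

-- If μ is apart from k, that factor is cancelled and the rest of the list remains. If |μ - k| <
-- 1/2, then μ is apart from all other candidates, their factors cancel, and (μ - k) v(i) = 0 for
-- all i. Apartness of μ from k would now make v vanish, so the dichotomy at every ε leaves only |μ
-- - k| < ε.
root-of-factors : ∀ {I : Set} μ ks (v : I → ℝ) → AllPairs Separated ks →
  ¬ (∀ i → v i ≃ 0ᵣ) → (∀ i → factors μ ks (v i) ≃ 0ᵣ) → ∃ λ k → μ ≃ fromℤ k
root-of-factors μ []       v _            v≄0 ann = contradiction ann v≄0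
root-of-factors μ (k ∷ ks) v (sep ∷ seps) v≄0 ann =
  decide (small⊎apart δ 0<δ (μ ⊝ fromℤ k))
  where
  δ = proj₁ (halve 1ℚ (ℚ.positive⁻¹ 1ℚ))
  0<δ = proj₁ (proj₂ (halve 1ℚ (ℚ.positive⁻¹ 1ℚ)))
  δ+δ≡1 = proj₂ (proj₂ (halve 1ℚ (ℚ.positive⁻¹ 1ℚ)))
  module _ (small : Small δ (μ ⊝ fromℤ k)) where
    others : All (λ l → Regular (μ ⊝ fromℤ l)) ks
    others = All.map (λ {l} s {x} → *-cancel-apart (μ ⊝ fromℤ l) {x}
      (separated⇒apart {δ} {μ} {k} {l} 0<δ δ+δ≡1 s small)) sep
    not-apart : ¬ Apart₀ (μ ⊝ fromℤ k)
    not-apart apart = v≄0 λ i → *-cancel-apart (μ ⊝ fromℤ k) apart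
      (factors-head k ks others {v i} (ann i))
    close : ∀ {ε} → Small ε (μ ⊝ fromℤ k) ⊎ Apart₀ (μ ⊝ fromℤ k) →
            ∃ λ N → ∀ n → N ℕ.≤ n → ∣ seq μ n ℚ.- seq (fromℤ k) n ∣ ℚ.< ε
    close {ε} (inj₁ (N , ε-small)) = N , λ n N≤n →
      subst (λ p → ∣ p ∣ ℚ.< ε) (seq-⊝ μ (fromℤ k) n) (ε-small n N≤n)
    close (inj₂ apart)   = contradiction apart not-apart
  decide : Small δ (μ ⊝ fromℤ k) ⊎ Apart₀ (μ ⊝ fromℤ k) → ∃ λ k → μ ≃ fromℤ k
  decide (inj₂ apart) = root-of-factors μ ks v seps v≄0 λ i → *-cancel-apart (μ ⊝ fromℤ k) apart (ann i)
  decide (inj₁ small) = k , ⟪ (λ ε 0<ε → close small (small⊎apart ε 0<ε (μ ⊝ fromℤ k))) ⟫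

-- Bisection

archimedean : ∀ p → ∃ λ N → p ℚ.< + suc N ℚ./ 1
archimedean p@(mkℚ (+ n) d c) = n , subst (p ℚ.<_) (sym (/1≡fromℤ (+ suc n)))
  (ℚ.*<* (subst₂ ℤ._<_ (ℤ.pos-* n 1) (ℤ.pos-* (suc n) (suc d))
    (ℤ.+<+ (ℕ.≤-<-trans (ℕ.≤-reflexive (ℕ.*-identityʳ n))
      (ℕ.<-≤-trans (ℕ.n<1+n n) (ℕ.m≤m*n (suc n) (suc d)))))))
archimedean p@(mkℚ -[1+ n ] d c) = n , subst (p ℚ.<_) (sym (/1≡fromℤ (+ suc n)))
  (ℚ.*<* ℤ.-<+)

opaque
  multiple-exceeds : ∀ p ε → 0ℚ ℚ.< ε → ∃ λ N → p ℚ.< (+ suc N ℚ./ 1) ℚ.* ε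
  multiple-exceeds p ε 0<ε =
    let ε⁻¹ , _ , εε⁻¹≡1 = quotient ε (ℚ.positive 0<ε) 1ℚ (ℚ.positive⁻¹ 1ℚ)
        N , p/ε<N = archimedean (p ℚ.* ε⁻¹)
    in N , subst (ℚ._< (+ suc N ℚ./ 1) ℚ.* ε)
         (trans (ℚ.*-assoc p ε⁻¹ ε)
           (trans (cong (p ℚ.*_) (trans (ℚ.*-comm ε⁻¹ ε) εε⁻¹≡1)) (ℚ.*-identityʳ p)))
         (ℚ.*-monoˡ-<-pos ε {{ℚ.positive 0<ε}} p/ε<N)

-- The inequality (n + 1)/2 ≤ n for n ≥ 1 with its difference written out. It lets a halved bracket
-- satisfy the bound on the width for the next index.
halved-width : ∀ h p q n → h ℚ.+ h ≡ 1ℚ → n ℚ.* (q ℚ.- p) ≡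
  (1ℚ ℚ.+ n) ℚ.* (h ℚ.* (q ℚ.- p)) ℚ.+ h ℚ.* ((n ℚ.- 1ℚ) ℚ.* (q ℚ.- p))
halved-width h p q n 2h≡1 = trans
  (trans (sym (ℚ.*-identityˡ _)) (cong (ℚ._* (n ℚ.* (q ℚ.- p))) (sym 2h≡1)))
  (identity h (q ℚ.- p) n)
  where
  identity : ∀ h w n → (h ℚ.+ h) ℚ.* (n ℚ.* w) ≡
    (1ℚ ℚ.+ n) ℚ.* (h ℚ.* w) ℚ.+ h ℚ.* ((n ℚ.- 1ℚ) ℚ.* w)
  identity = solve 3 (λ h w n → (h :+ h) :* (n :* w) :=
    (con 1ℚ :+ n) :* (h :* w) :+ h :* ((n :- con 1ℚ) :* w)) refl

-- One root approached from two sides. Keeping a sequence for each sign preserves rational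
-- inequalities at every term, which the common limit alone would lose.
record Crossing (f : ℚ → ℚ) (a b : ℚ) : Set where
  field
    lower upper : ℝ
    lower≃upper : lower ≃ upper
    a≤lower     : ∀ n → a ℚ.≤ seq lower n
    lower≤upper : ∀ n → seq lower n ℚ.≤ seq upper n
    upper≤b     : ∀ n → seq upper n ℚ.≤ b
    f-lower≤0   : ∀ n → f (seq lower n) ℚ.≤ 0ℚ
    0<f-upper   : ∀ n → 0ℚ ℚ.< f (seq upper n)

module Bisection (f : ℚ → ℚ) (a b : ℚ) (a≤b : a ℚ.≤ b)
                 (fa≤0 : f a ℚ.≤ 0ℚ) (0<fb : 0ℚ ℚ.< f b)
                 (h : ℚ) (0<h : 0ℚ ℚ.< h) (2h≡1 : h ℚ.+ h ≡ 1ℚ) where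

  record Bracket (n : ℕ) : Set where
    field
      l u   : ℚ
      a≤l   : a ℚ.≤ l
      l≤u   : l ℚ.≤ u
      u≤b   : u ℚ.≤ b
      fl≤0  : f l ℚ.≤ 0ℚ
      0<fu  : 0ℚ ℚ.< f u
      -- The bound (b - a)/(n + 1) is weaker than (b - a)/2ⁿ, but it suffices for convergence and
      -- needs no powers.
      width : (+ suc n ℚ./ 1) ℚ.* (u ℚ.- l) ℚ.≤ b ℚ.- a

  open Bracket

  record _⊇_ {m n} (B : Bracket m) (C : Bracket n) : Set where
    constructor _,_
    field
      l≤l : l B ℚ.≤ l C
      u≤u : u C ℚ.≤ u B

  open _⊇_

  ⊇-refl : ∀ {n} {B : Bracket n} → B ⊇ B
  ⊇-refl = ℚ.≤-refl , ℚ.≤-refl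

  ⊇-trans : ∀ {m n o} {B : Bracket m} {C : Bracket n} {D : Bracket o} →
            B ⊇ C → C ⊇ D → B ⊇ D
  ⊇-trans (p , q) (r , s) = ℚ.≤-trans p r , ℚ.≤-trans s q

  0≤h = ℚ.<⇒≤ 0<h

  middle : ∀ p q → ∃ λ m → m ≡ p ℚ.+ h ℚ.* (q ℚ.- p) × q ≡ m ℚ.+ h ℚ.* (q ℚ.- p)
  middle p q = p ℚ.+ h ℚ.* (q ℚ.- p) , refl , trans
    (trans (sum-diff p q) (cong (p ℚ.+_) (trans (sym (ℚ.*-identityˡ _))
      (cong (ℚ._* (q ℚ.- p)) (sym 2h≡1)))))
    (identity h p (q ℚ.- p))
    where
    sum-diff : ∀ p q → q ≡ p ℚ.+ (q ℚ.- p)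
    sum-diff = solve 2 (λ p q → q := p :+ (q :- p)) refl
    identity : ∀ h p w → p ℚ.+ (h ℚ.+ h) ℚ.* w ≡ (p ℚ.+ h ℚ.* w) ℚ.+ h ℚ.* w
    identity = solve 3 (λ h p w → p :+ (h :+ h) :* w := (p :+ h :* w) :+ h :* w) refl

  cancel-left : ∀ {p q r} → p ≡ q ℚ.+ r → p ℚ.- q ≡ r
  cancel-left {p} {q} {r} p≡ = trans (cong (ℚ._- q) p≡) (identity q r)
    where
    identity : ∀ q r → (q ℚ.+ r) ℚ.- q ≡ r
    identity = solve 2 (λ q r → (q :+ r) :- q := r) refl

  refine : ∀ n (B : Bracket n) → ∃ λ (C : Bracket (suc n)) → B ⊇ C
  refine n B = choose (f m ℚ.≤? 0ℚ)
    where
    w = u B ℚ.- l B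
    m = proj₁ (middle (l B) (u B))
    m≡ : m ≡ l B ℚ.+ h ℚ.* w
    m≡ = proj₁ (proj₂ (middle (l B) (u B)))
    u≡ : u B ≡ m ℚ.+ h ℚ.* w
    u≡ = proj₂ (proj₂ (middle (l B) (u B)))
    0≤hw : 0ℚ ℚ.≤ h ℚ.* w
    0≤hw = 0≤p*q 0≤h (p≤q⇒0≤q-p (l≤u B))
    l≤m : l B ℚ.≤ m
    l≤m = ≤-from-difference 0≤hw m≡
    m≤u : m ℚ.≤ u B
    m≤u = ≤-from-difference 0≤hw u≡
    N = + suc n ℚ./ 1
    1≤N : 1ℚ ℚ.≤ N
    1≤N = /1-mono-≤ {+ 1} {+ suc n} (ℤ.+≤+ (s≤s z≤n))
    narrower : (+ suc (suc n) ℚ./ 1) ℚ.* (h ℚ.* w) ℚ.≤ b ℚ.- a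
    narrower = ℚ.≤-trans
      (ℚ.≤-reflexive (cong (ℚ._* (h ℚ.* w)) (/1-homo-+ (+ 1) (+ suc n))))
      (ℚ.≤-trans
        (≤-from-difference (0≤p*q 0≤h (0≤p*q (p≤q⇒0≤q-p 1≤N) (p≤q⇒0≤q-p (l≤u B))))
                 (halved-width h (l B) (u B) N 2h≡1))
        (width B))
    choose : Dec (f m ℚ.≤ 0ℚ) → ∃ λ (C : Bracket (suc n)) → B ⊇ C
    choose (yes fm≤0) = record
      { l = m ; u = u B ; a≤l = ℚ.≤-trans (a≤l B) l≤m ; l≤u = m≤u ; u≤b = u≤b B
      ; fl≤0 = fm≤0 ; 0<fu = 0<fu B
      ; width = subst (λ v → (+ suc (suc n) ℚ./ 1) ℚ.* v ℚ.≤ b ℚ.- a)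
                  (sym (cancel-left u≡)) narrower
      } , (l≤m , ℚ.≤-refl)
    choose (no fm≰0) = record
      { l = l B ; u = m ; a≤l = a≤l B ; l≤u = l≤m ; u≤b = ℚ.≤-trans m≤u (u≤b B)
      ; fl≤0 = fl≤0 B ; 0<fu = ℚ.≰⇒> fm≰0
      ; width = subst (λ v → (+ suc (suc n) ℚ./ 1) ℚ.* v ℚ.≤ b ℚ.- a)
                  (sym (cancel-left m≡)) narrower
      } , (ℚ.≤-refl , m≤u)

  bracket : ∀ n → Bracket n
  bracket zero    = record
    { l = a ; u = b ; a≤l = ℚ.≤-refl ; l≤u = a≤b ; u≤b = ℚ.≤-refl
    ; fl≤0 = fa≤0 ; 0<fu = 0<fb
    ; width = ℚ.≤-reflexive (ℚ.*-identityˡ (b ℚ.- a))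
    }
  bracket (suc n) = proj₁ (refine n (bracket n))

  nested : ∀ m k → bracket m ⊇ bracket (k ℕ.+ m)
  nested m zero    = ⊇-refl
  nested m (suc k) = ⊇-trans (nested m k) (proj₂ (refine (k ℕ.+ m) (bracket (k ℕ.+ m))))

  nested-≤ : ∀ {m n} → m ℕ.≤ n → bracket m ⊇ bracket n
  nested-≤ {m} {n} m≤n = subst (λ o → bracket m ⊇ bracket o) (ℕ.m∸n+n≡m m≤n) (nested m (n ℕ.∸ m))

  narrow : ∀ ε → 0ℚ ℚ.< ε → ∃ λ N → u (bracket N) ℚ.- l (bracket N) ℚ.< ε
  narrow ε 0<ε =
    let N , b-a<Nε = multiple-exceeds (b ℚ.- a) ε 0<ε
    in N , ℚ.*-cancelˡ-<-nonNeg (+ suc N ℚ./ 1)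
         {{ℚ.nonNegative (/1-mono-≤ {+ 0} {+ suc N} (ℤ.+≤+ z≤n))}}
         (ℚ.≤-<-trans (width (bracket N)) b-a<Nε)

  within : ∀ {p q x y} → p ℚ.≤ x → x ℚ.≤ q → p ℚ.≤ y → y ℚ.≤ q → ∀ {ε} →
           q ℚ.- p ℚ.< ε → ∣ x ℚ.- y ∣ ℚ.< ε
  within {p} {q} {x} {y} p≤x x≤q p≤y y≤q {ε} q-p<ε = ∣p∣<ε
    (ℚ.≤-<-trans (ℚ.+-mono-≤ x≤q (ℚ.neg-antimono-≤ p≤y)) q-p<ε)
    (subst (ℚ._< ε) (sym (neg-diff x y))
      (ℚ.≤-<-trans (ℚ.+-mono-≤ y≤q (ℚ.neg-antimono-≤ p≤x)) q-p<ε))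
    where
    neg-diff : ∀ x y → ℚ.- (x ℚ.- y) ≡ y ℚ.- x
    neg-diff = solve 2 (λ x y → :- (x :- y) := y :- x) refl

  crossing : Crossing f a b
  crossing = record
    { lower       = mkℝ (λ n → l (bracket n)) λ ε 0<ε →
        let N , small = narrow ε 0<ε in N , λ m n N≤m N≤n →
        within (l≤l (nested-≤ N≤m)) (ℚ.≤-trans (l≤u (bracket m)) (u≤u (nested-≤ N≤m)))
               (l≤l (nested-≤ N≤n)) (ℚ.≤-trans (l≤u (bracket n)) (u≤u (nested-≤ N≤n))) small
    ; upper       = mkℝ (λ n → u (bracket n)) λ ε 0<ε →
        let N , small = narrow ε 0<ε in N , λ m n N≤m N≤n →
        within (ℚ.≤-trans (l≤l (nested-≤ N≤m)) (l≤u (bracket m))) (u≤u (nested-≤ N≤m))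
               (ℚ.≤-trans (l≤l (nested-≤ N≤n)) (l≤u (bracket n))) (u≤u (nested-≤ N≤n)) small
    ; lower≃upper = ⟪ (λ ε 0<ε →
        let N , small = narrow ε 0<ε in N , λ n N≤n →
        within (l≤l (nested-≤ N≤n)) (ℚ.≤-trans (l≤u (bracket n)) (u≤u (nested-≤ N≤n)))
               (ℚ.≤-trans (l≤l (nested-≤ N≤n)) (l≤u (bracket n))) (u≤u (nested-≤ N≤n)) small) ⟫
    ; a≤lower     = λ n → a≤l (bracket n)
    ; lower≤upper = λ n → l≤u (bracket n)
    ; upper≤b     = λ n → u≤b (bracket n)
    ; f-lower≤0   = λ n → fl≤0 (bracket n)
    ; 0<f-upper   = λ n → 0<fu (bracket n)
    }

opaque
  crossing : ∀ f a b → a ℚ.≤ b → f a ℚ.≤ 0ℚ → 0ℚ ℚ.< f b → Crossing f a b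
  crossing f a b a≤b fa≤0 0<fb =
    let h , 0<h , 2h≡1 = halve 1ℚ (ℚ.positive⁻¹ 1ℚ)
    in Bisection.crossing f a b a≤b fa≤0 0<fb h 0<h 2h≡1

-- Extensionality takes the place of a continuity estimate: F acts termwise as f and respects `_≃_`,
-- so applying it to `lower≃upper` shows that f(upper) - f(lower) tends to 0.
module CrossingProperties {f a b} (c : Crossing f a b) (F : ℝ → ℝ)
  (seq-F : ∀ x n → seq (F x) n ≡ f (seq x n)) (F-cong : ∀ {x y} → x ≃ y → F x ≃ F y)
  where
  open Crossing c

  upper-lower<ε : ∀ ε → 0ℚ ℚ.< ε → ∃ λ N → ∀ n → N ℕ.≤ n →
                  f (seq upper n) ℚ.- f (seq lower n) ℚ.< ε
  upper-lower<ε ε 0<ε =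
    let N , close = F-cong lower≃upper .limit ε 0<ε
    in N , λ n N≤n → ℚ.≤-<-trans
         (ℚ.≤-trans (p≤∣p∣ _) (ℚ.≤-reflexive (∣p-q∣≡∣q-p∣ (f (seq upper n)) (f (seq lower n)))))
         (subst₂ (λ p q → ∣ p ℚ.- q ∣ ℚ.< ε) (seq-F lower n) (seq-F upper n) (close n N≤n))

  root : F lower ≃ 0ᵣ
  root = ⟪ (λ ε 0<ε →
    let N , close = upper-lower<ε ε 0<ε
    in N , λ n N≤n → subst (λ p → ∣ p ∣ ℚ.< ε)
         (sym (trans (ℚ.+-identityʳ _) (seq-F lower n)))
         (∣p∣<ε (ℚ.≤-<-trans (f-lower≤0 n) 0<ε)
           (ℚ.≤-<-trans
             (ℚ.≤-trans (ℚ.≤-reflexive (sym (ℚ.+-identityˡ _)))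
                        (ℚ.+-monoˡ-≤ _ (ℚ.<⇒≤ (0<f-upper n))))
             (close n N≤n)))) ⟫

  small-value : ∀ ε → 0ℚ ℚ.< ε → ∃ λ u →
    a ℚ.≤ u × u ℚ.≤ b × 0ℚ ℚ.< f u × f u ℚ.< ε
  small-value ε 0<ε =
    let N , close = upper-lower<ε ε 0<ε
    in seq upper N
     , ℚ.≤-trans (a≤lower N) (lower≤upper N)
     , upper≤b N
     , 0<f-upper N
     , ℚ.≤-<-trans
         (ℚ.≤-trans (ℚ.≤-reflexive (sym (ℚ.+-identityʳ _)))
                    (ℚ.+-monoʳ-≤ (f (seq upper N)) (ℚ.neg-antimono-≤ (f-lower≤0 N))))
         (close N ℕ.≤-refl)

-- Rational brackets for the roots of Chebyshev polynomials

-- Chebyshev polynomials of the second kind, rescaled: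
-- U (2 cos θ) k = sin (k θ) / sin θ.
U : ℚ → ℕ → ℚ
U x 0             = 0ℚ
U x 1             = 1ℚ
U x (suc (suc k)) = x ℚ.* U x (suc k) ℚ.- U x k

Uᵣ : ℝ → ℕ → ℝ
Uᵣ x 0             = 0ᵣ
Uᵣ x 1             = 1ᵣ
Uᵣ x (suc (suc k)) = x ⊗ Uᵣ x (suc k) ⊝ Uᵣ x k

seq-U : ∀ k x n → seq (Uᵣ x k) n ≡ U (seq x n) k
seq-U 0             x n = refl
seq-U 1             x n = refl
seq-U (suc (suc k)) x n = trans (seq-⊝ _ _ n) (cong₂ ℚ._-_
  (trans (seq-⊗ _ _ n) (cong (seq x n ℚ.*_) (seq-U (suc k) x n))) (seq-U k x n))

Uᵣ-cong : ∀ k {x y} → x ≃ y → Uᵣ x k ≃ Uᵣ y k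
Uᵣ-cong 0             x≃y = ℝ-Ring.refl
Uᵣ-cong 1             x≃y = ℝ-Ring.refl
Uᵣ-cong (suc (suc k)) x≃y = ℝ-Ring.+-cong
  (ℝ-Ring.*-cong x≃y (Uᵣ-cong (suc k) x≃y)) (ℝ-Ring.-‿cong (Uᵣ-cong k x≃y))

2ℚ : ℚ
2ℚ = + 2 ℚ./ 1

-- The limit θ → 0 of sin (kθ) / sin θ. It makes 2 a point where all these polynomials are positive,
-- the right end of each bisection in `next-root`.
U-2 : ∀ k → U 2ℚ k ≡ + k ℚ./ 1
U-2 0             = refl
U-2 1             = refl
U-2 (suc (suc k)) = trans (cong₂ (λ p q → 2ℚ ℚ.* p ℚ.- q) (U-2 (suc k)) (U-2 k))
  (trans (cong (λ p → 2ℚ ℚ.* p ℚ.- k/1) (/1-homo-+ (+ 1) (+ k)))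
    (trans (identity k/1)
      (sym (trans (/1-homo-+ (+ 1) (+ suc k)) (cong (1ℚ ℚ.+_) (/1-homo-+ (+ 1) (+ k)))))))
  where
  k/1 = + k ℚ./ 1
  identity : ∀ p → 2ℚ ℚ.* (1ℚ ℚ.+ p) ℚ.- p ≡ 1ℚ ℚ.+ (1ℚ ℚ.+ p)
  identity = solve 1 (λ p → con 2ℚ :* (con 1ℚ :+ p) :- p := con 1ℚ :+ (con 1ℚ :+ p)) refl

0<U-2 : ∀ k → 0ℚ ℚ.< U 2ℚ (suc k)
0<U-2 k = subst (0ℚ ℚ.<_) (sym (U-2 (suc k)))
  (ℚ.<-≤-trans (ℚ.positive⁻¹ 1ℚ) (/1-mono-≤ {+ 1} {+ suc k} (ℤ.+≤+ (s≤s z≤n))))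

PositiveBelow : ℚ → ℕ → Set
PositiveBelow x k = ∀ i → i ℕ.< k → 0ℚ ℚ.< U x (suc i)

-- The second component says that U u k / U q k increases with k; it is the
-- Wronskian of the recurrences at q and u.
U-mono : ∀ {q u} → q ℚ.≤ u → ∀ k → PositiveBelow q (suc k) →
  U q (suc k) ℚ.≤ U u (suc k) ×
  U q (suc (suc k)) ℚ.* U u (suc k) ℚ.≤ U u (suc (suc k)) ℚ.* U q (suc k)
U-mono {q} {u} q≤u zero    pos = ℚ.≤-refl , ≤-from-difference (p≤q⇒0≤q-p q≤u) (identity q u)
  where
  identity : ∀ q u → (u ℚ.* 1ℚ ℚ.- 0ℚ) ℚ.* 1ℚ ≡ (q ℚ.* 1ℚ ℚ.- 0ℚ) ℚ.* 1ℚ ℚ.+ (u ℚ.- q)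
  identity = solve 2 (λ q u → (u :* con 1ℚ :- con 0ℚ) :* con 1ℚ
    := (q :* con 1ℚ :- con 0ℚ) :* con 1ℚ :+ (u :- q)) refl
U-mono {q} {u} q≤u (suc k) pos = values , ratios
  where
  open ℚ.≤-Reasoning
  a = U u (suc (suc k))
  b = U u (suc k)
  c = U q (suc (suc k))
  d = U q (suc k)
  previous = U-mono q≤u k (λ i i<k → pos i (ℕ.m≤n⇒m≤1+n i<k))
  d≤b : d ℚ.≤ b
  d≤b = proj₁ previous
  cb≤ad : c ℚ.* b ℚ.≤ a ℚ.* d
  cb≤ad = proj₂ previous
  0<c : 0ℚ ℚ.< c
  0<c = pos (suc k) ℕ.≤-refl
  0<d : 0ℚ ℚ.< d
  0<d = pos k (ℕ.n≤1+n _)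
  values : c ℚ.≤ a
  values = ℚ.*-cancelʳ-≤-pos d {{ℚ.positive 0<d}} (begin
    c ℚ.* d  ≤⟨ ℚ.*-monoˡ-≤-nonNeg c {{ℚ.nonNegative (ℚ.<⇒≤ 0<c)}} d≤b ⟩
    c ℚ.* b  ≤⟨ cb≤ad ⟩
    a ℚ.* d  ∎)
  -- From one index to the next the Wronskian grows by (u - q) a c, which is nonnegative.
  identity : ∀ q u a b c d → (u ℚ.* a ℚ.- b) ℚ.* c ≡
    (q ℚ.* c ℚ.- d) ℚ.* a ℚ.+ ((u ℚ.- q) ℚ.* (a ℚ.* c) ℚ.+ (a ℚ.* d ℚ.- c ℚ.* b))
  identity = solve 6 (λ q u a b c d → (u :* a :- b) :* c :=
    (q :* c :- d) :* a :+ ((u :- q) :* (a :* c) :+ (a :* d :- c :* b))) refl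
  ratios : (q ℚ.* c ℚ.- d) ℚ.* a ℚ.≤ (u ℚ.* a ℚ.- b) ℚ.* c
  ratios = ≤-from-difference
    (ℚ.+-mono-≤
      (0≤p*q (p≤q⇒0≤q-p q≤u) (0≤p*q (ℚ.≤-trans (ℚ.<⇒≤ 0<c) values) (ℚ.<⇒≤ 0<c)))
      (p≤q⇒0≤q-p cb≤ad))
    (identity q u a b c d)

-- q lies between the two largest roots 2 cos (2π/k) and 2 cos (π/k) of U · k.
record BelowLargestRoot (r : ℚ) (k : ℕ) : Set where
  field
    q        : ℚ
    r≤q      : r ℚ.≤ q
    q<2      : q ℚ.< 2ℚ
    positive : ∀ i → suc i ℕ.< k → 0ℚ ℚ.< U q (suc i)
    nonpos   : U q k ℚ.≤ 0ℚ

-- In `next-root`, x and y are consecutive values at u: x is made small by choosing u close to a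
-- root, while y stays above a fixed bound 2γ.
recurrence-nonpos : ∀ {u x y γ} → u ℚ.≤ 2ℚ → 0ℚ ℚ.≤ x → x ℚ.≤ γ → γ ℚ.+ γ ℚ.≤ y →
                    u ℚ.* x ℚ.- y ℚ.≤ 0ℚ
recurrence-nonpos {u} {x} {y} {γ} u≤2 0≤x x≤γ 2γ≤y = begin
  u ℚ.* x ℚ.- y                ≤⟨ ℚ.+-mono-≤ (ℚ.*-monoʳ-≤-nonNeg x {{ℚ.nonNegative 0≤x}} u≤2)
                                             (ℚ.neg-antimono-≤ 2γ≤y) ⟩
  2ℚ ℚ.* x ℚ.- (γ ℚ.+ γ)       ≡⟨ cong (ℚ._- (γ ℚ.+ γ)) (sym (p+p≡2p x)) ⟩
  (x ℚ.+ x) ℚ.- (γ ℚ.+ γ)      ≤⟨ ℚ.+-monoˡ-≤ (ℚ.- (γ ℚ.+ γ)) (ℚ.+-mono-≤ x≤γ x≤γ) ⟩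
  (γ ℚ.+ γ) ℚ.- (γ ℚ.+ γ)      ≡⟨ ℚ.+-inverseʳ (γ ℚ.+ γ) ⟩
  0ℚ                           ∎
  where open ℚ.≤-Reasoning

-- Just above the largest root of U · k, the recurrence gives U · (k + 1)
-- the sign of - U · (k - 1).
next-root : ∀ {r} k → BelowLargestRoot r (2 ℕ.+ k) → BelowLargestRoot r (3 ℕ.+ k)
next-root {r} k B = record
  { q        = u
  ; r≤q      = ℚ.≤-trans r≤q q≤u
  ; q<2      = ℚ.≰⇒> λ 2≤u → <⇒≱ (0<U-2 (2 ℕ.+ k))
      (subst (λ x → U x (3 ℕ.+ k) ℚ.≤ 0ℚ) (ℚ.≤-antisym u≤2 2≤u) nonpos′)
  ; positive = positive′
  ; nonpos   = nonpos′
  }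
  where
  open BelowLargestRoot B
  below : ∀ j → j ℕ.≤ k → PositiveBelow q (suc j)
  below j j≤k i i<j = positive i (s≤s (ℕ.≤-trans i<j (s≤s j≤k)))
  -- γ is fixed before u is chosen: by monotonicity `U u (suc k)` ≥ `U q (suc k)` = 2γ for every u ≥
  -- q, so it remains to find u ≥ q with 0 < `U u (2 ℕ.+ k)` < γ.
  γ-lemma = halve (U q (suc k)) (positive k ℕ.≤-refl)
  γ = proj₁ γ-lemma
  0<γ = proj₁ (proj₂ γ-lemma)
  2γ≡ = proj₂ (proj₂ γ-lemma)
  cross : Crossing (λ x → U x (2 ℕ.+ k)) q 2ℚ
  cross = crossing (λ x → U x (2 ℕ.+ k)) q 2ℚ (ℚ.<⇒≤ q<2) nonpos (0<U-2 (suc k))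
  open CrossingProperties cross (λ x → Uᵣ x (2 ℕ.+ k)) (seq-U (2 ℕ.+ k)) (Uᵣ-cong (2 ℕ.+ k))
  small = small-value γ 0<γ
  u = proj₁ small
  q≤u = proj₁ (proj₂ small)
  u≤2 = proj₁ (proj₂ (proj₂ small))
  0<Uu = proj₁ (proj₂ (proj₂ (proj₂ small)))
  Uu<γ = proj₂ (proj₂ (proj₂ (proj₂ small)))
  positive′ : ∀ i → suc i ℕ.< 3 ℕ.+ k → 0ℚ ℚ.< U u (suc i)
  positive′ i (s≤s (s≤s i≤1+k)) = last-or-earlier (ℕ.m≤n⇒m<n∨m≡n i≤1+k)
    where
    last-or-earlier : i ℕ.< suc k ⊎ i ≡ suc k → 0ℚ ℚ.< U u (suc i)
    last-or-earlier (inj₂ i≡1+k) = subst (λ j → 0ℚ ℚ.< U u (suc j)) (sym i≡1+k) 0<Uu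
    last-or-earlier (inj₁ (s≤s i≤k)) = ℚ.<-≤-trans (positive i (s≤s (s≤s i≤k)))
                                         (proj₁ (U-mono q≤u i (below i i≤k)))
  nonpos′ : u ℚ.* U u (2 ℕ.+ k) ℚ.- U u (suc k) ℚ.≤ 0ℚ
  nonpos′ = recurrence-nonpos u≤2 (ℚ.<⇒≤ 0<Uu) (ℚ.<⇒≤ Uu<γ)
    (ℚ.≤-trans (ℚ.≤-reflexive 2γ≡) (proj₁ (U-mono q≤u k (below k ℕ.≤-refl))))

-- The constant 7/4 has square 49/16 > 3 and lies below 2 cos (π/7) ≈ 1.802, but above 2 cos (π/6) =
-- √3; hence the start at 7.
below-largest-root : ∀ k → BelowLargestRoot (+ 7 ℚ./ 4) (7 ℕ.+ k)
below-largest-root zero    = record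
  { q        = + 7 ℚ./ 4
  ; r≤q      = ℚ.≤-refl
  ; q<2      = toWitness {a? = (+ 7 ℚ./ 4) ℚ.<? 2ℚ} tt
  ; positive = λ
    { 0 _ → toWitness {a? = 0ℚ ℚ.<? U (+ 7 ℚ./ 4) 1} tt
    ; 1 _ → toWitness {a? = 0ℚ ℚ.<? U (+ 7 ℚ./ 4) 2} tt
    ; 2 _ → toWitness {a? = 0ℚ ℚ.<? U (+ 7 ℚ./ 4) 3} tt
    ; 3 _ → toWitness {a? = 0ℚ ℚ.<? U (+ 7 ℚ./ 4) 4} tt
    ; 4 _ → toWitness {a? = 0ℚ ℚ.<? U (+ 7 ℚ./ 4) 5} tt
    ; 5 _ → toWitness {a? = 0ℚ ℚ.<? U (+ 7 ℚ./ 4) 6} tt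
    ; (suc (suc (suc (suc (suc (suc i)))))) (s≤s (s≤s (s≤s (s≤s (s≤s (s≤s (s≤s ()))))))) }
  ; nonpos   = toWitness {a? = U (+ 7 ℚ./ 4) 7 ℚ.≤? 0ℚ} tt
  }
below-largest-root (suc k) = next-root (5 ℕ.+ k) (below-largest-root k)

-- An interval in which U · m has a root whose square is not an integer.
record RootInterval (m : ℕ) : Set where
  field
    a b  : ℚ
    z    : ℤ
    0<a  : 0ℚ ℚ.< a
    a≤b  : a ℚ.≤ b
    Ua≤0 : U a m ℚ.≤ 0ℚ
    0<Ub : 0ℚ ℚ.< U b m
    z<a² : z ℚ./ 1 ℚ.< a ℚ.* a
    b²<z+1 : b ℚ.* b ℚ.< (z ℤ.+ + 1) ℚ./ 1

square-mono-≤ : ∀ {p q} → 0ℚ ℚ.≤ p → p ℚ.≤ q → p ℚ.* p ℚ.≤ q ℚ.* q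
square-mono-≤ {p} {q} 0≤p p≤q = ℚ.≤-trans
  (ℚ.*-monoˡ-≤-nonNeg p {{ℚ.nonNegative 0≤p}} p≤q)
  (ℚ.*-monoʳ-≤-nonNeg q {{ℚ.nonNegative (ℚ.≤-trans 0≤p p≤q)}} p≤q)

-- `U x 5` is x⁴ - 3x² + 1, whose largest root is the golden ratio, with square about 2.618; the
-- squares of the endpoints are 2.25 and 2.89.
root-interval-5 : RootInterval 5
root-interval-5 = record
  { a = + 3 ℚ./ 2 ; b = + 17 ℚ./ 10 ; z = + 2
  ; 0<a    = toWitness {a? = 0ℚ ℚ.<? (+ 3 ℚ./ 2)} tt
  ; a≤b    = toWitness {a? = (+ 3 ℚ./ 2) ℚ.≤? (+ 17 ℚ./ 10)} tt
  ; Ua≤0   = toWitness {a? = U (+ 3 ℚ./ 2) 5 ℚ.≤? 0ℚ} tt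
  ; 0<Ub   = toWitness {a? = 0ℚ ℚ.<? U (+ 17 ℚ./ 10) 5} tt
  ; z<a²   = toWitness {a? = (+ 2 ℚ./ 1) ℚ.<? (+ 3 ℚ./ 2) ℚ.* (+ 3 ℚ./ 2)} tt
  ; b²<z+1 = toWitness {a? = (+ 17 ℚ./ 10) ℚ.* (+ 17 ℚ./ 10) ℚ.<? (+ 3 ℚ./ 1)} tt
  }

-- The points for two consecutive indices enclose a root of the lower polynomial: it is nonpositive
-- at the first, and positivity below the higher index makes it positive at the second. In the
-- reverse order, `U-mono` would make it positive at the first point too.
root-interval-between : ∀ {r m z} → 0ℚ ℚ.< r → z ℚ./ 1 ℚ.< r ℚ.* r →
  2ℚ ℚ.* 2ℚ ≡ (z ℤ.+ + 1) ℚ./ 1 →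
  BelowLargestRoot r (suc m) → BelowLargestRoot r (suc (suc m)) → RootInterval (suc m)
root-interval-between {r} {m} {z} 0<r z<r² 4≡z+1 A B = record
  { a = A.q ; b = B.q ; z = z
  ; 0<a    = ℚ.<-≤-trans 0<r A.r≤q
  ; a≤b    = a≤b (ℚ.≤-total A.q B.q)
  ; Ua≤0   = A.nonpos
  ; 0<Ub   = B.positive m ℕ.≤-refl
  ; z<a²   = ℚ.<-≤-trans z<r² (square-mono-≤ (ℚ.<⇒≤ 0<r) A.r≤q)
  ; b²<z+1 = subst (B.q ℚ.* B.q ℚ.<_) 4≡z+1
      (ℚ.<-≤-trans (ℚ.*-monoʳ-<-pos B.q {{ℚ.positive (ℚ.<-≤-trans 0<r B.r≤q)}} B.q<2)
                   (ℚ.*-monoʳ-≤-nonNeg 2ℚ (ℚ.<⇒≤ B.q<2)))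
  }
  where
  module A = BelowLargestRoot A
  module B = BelowLargestRoot B
  a≤b : A.q ℚ.≤ B.q ⊎ B.q ℚ.≤ A.q → A.q ℚ.≤ B.q
  a≤b (inj₁ a≤b) = a≤b
  a≤b (inj₂ b≤a) = contradiction A.nonpos (<⇒≱ (ℚ.<-≤-trans
    (B.positive m ℕ.≤-refl)
    (proj₁ (U-mono b≤a m λ i i<1+m → B.positive i (s≤s i<1+m)))))

root-interval-7+ : ∀ k → RootInterval (7 ℕ.+ k)
root-interval-7+ k = root-interval-between {z = + 3}
  (toWitness {a? = 0ℚ ℚ.<? (+ 7 ℚ./ 4)} tt)
  (toWitness {a? = (+ 3 ℚ./ 1) ℚ.<? (+ 7 ℚ./ 4) ℚ.* (+ 7 ℚ./ 4)} tt)
  refl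
  (below-largest-root k) (below-largest-root (suc k))

-- Eigenvalue equations restated in the ring of reals

foldr-cong : ∀ {A : Set} {_∙_ _∘_ : A → A → A} {ε : A} → (∀ x y → (x ∙ y) ≡ (x ∘ y)) →
  ∀ {n} {f g : Vector A n} → (∀ i → f i ≡ g i) → Vector.foldr _∙_ ε f ≡ Vector.foldr _∘_ ε g
foldr-cong ∙≡∘ {zero}  f≗g = refl
foldr-cong {_∘_ = _∘_} ∙≡∘ {suc n} f≗g =
  trans (∙≡∘ _ _) (cong₂ _∘_ (f≗g zero) (foldr-cong ∙≡∘ (λ i → f≗g (suc i))))

sumᵣ-⊗ : ∀ {r} (a v : Vector ℝ r) → sumᵣ (λ j → a j *ᵣ v j) ≡ sum (λ j → a j ⊗ v j)
sumᵣ-⊗ a v = foldr-cong (λ x y → sym (⊕-def x y)) (λ j → sym (⊗-def (a j) (v j)))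

≃⇒IsEigenvalue : ∀ {n} (A : Matrix n) μ v → ¬ (∀ i → v i ≃ 0ᵣ) →
                 (∀ i → (A *ᵥ v) i ≃ μ ⊗ v i) → IsEigenvalue A μ
≃⇒IsEigenvalue A μ v v≄0 eigen = v , (λ v≈0 → v≄0 λ i → ⟪ v≈0 i ⟫) , λ i →
  limit (subst ((A *ᵥ v) i ≃_) (⊗-def μ (v i)) (eigen i))

eigen⇒≃ : ∀ {n} (A : Matrix n) μ v → (∀ i → (A *ᵥ v) i ≈ᵣ μ *ᵣ v i) →
          ∀ i → (A *ᵥ v) i ≃ μ ⊗ v i
eigen⇒≃ A μ v eigen i = subst ((A *ᵥ v) i ≃_) (sym (⊗-def μ (v i))) ⟪ eigen i ⟫

-- Neighbours in the Cayley graph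

module Neighbours {m r} (T : TranspositionSet m)
  (t : Fin r → Permutation′ m)
  (t-member : ∀ k → TranspositionSet.member T (t k))
  (t-onto : ∀ π → TranspositionSet.member T π → ∃ λ k → π Perm.≈ t k)
  (t-injective : ∀ k l → t k Perm.≈ t l → k ≡ l)
  (t-involutive : ∀ k x → t k ⟨$⟩ʳ (t k ⟨$⟩ʳ x) ≡ x)
  where

  open TranspositionSet T

  neighbour : Fin r → Fin (m !) → Fin (m !)
  neighbour k i = encode m (decode m i ∘ₚ t k)

  decode-neighbour : ∀ k i x → decode m (neighbour k i) ⟨$⟩ʳ x ≡ t k ⟨$⟩ʳ (decode m i ⟨$⟩ʳ x)
  decode-neighbour k i = decode-encode m (decode m i ∘ₚ t k)

  Adjacent : Fin (m !) → Fin (m !) → Set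
  Adjacent i j = member (flip (decode m j) ∘ₚ decode m i)

  neighbour-adjacent : ∀ k i → Adjacent i (neighbour k i)
  neighbour-adjacent k i = resp {t k} {flip τ ∘ₚ σ}
    (λ x → trans (cong (t k ⟨$⟩ʳ_) (trans (sym (Perm.inverseʳ τ)) (decode-neighbour k i (τ ⟨$⟩ˡ x))))
                 (t-involutive k (σ ⟨$⟩ʳ (τ ⟨$⟩ˡ x))))
    (t-member k)
    where
    σ = decode m i
    τ = decode m (neighbour k i)

  neighbour-onto : ∀ i j → Adjacent i j → ∃ λ k → neighbour k i ≡ j
  neighbour-onto i j i~j = k , trans (encode-cong m (σ ∘ₚ t k) τ tσ≈τ) (encode-decode m j)
    where
    σ = decode m i
    τ = decode m j
    found = t-onto (flip τ ∘ₚ σ) i~j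
    k = proj₁ found
    tσ≈τ : ∀ x → t k ⟨$⟩ʳ (σ ⟨$⟩ʳ x) ≡ τ ⟨$⟩ʳ x
    tσ≈τ x = trans
      (cong (t k ⟨$⟩ʳ_) (trans (cong (σ ⟨$⟩ʳ_) (sym (Perm.inverseˡ τ {x}))) (proj₂ found (τ ⟨$⟩ʳ x))))
      (t-involutive k (τ ⟨$⟩ʳ x))

  neighbour-injective : ∀ i k l → neighbour k i ≡ neighbour l i → k ≡ l
  neighbour-injective i k l eq = t-injective k l λ x → trans
    (cong (t k ⟨$⟩ʳ_) (sym (Perm.inverseʳ σ)))
    (trans (sym (decode-neighbour k i (σ ⟨$⟩ˡ x)))
      (trans (cong (λ j → decode m j ⟨$⟩ʳ (σ ⟨$⟩ˡ x)) eq)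
        (trans (decode-neighbour l i (σ ⟨$⟩ˡ x)) (cong (t l ⟨$⟩ʳ_) (Perm.inverseʳ σ)))))
    where σ = decode m i

  adjacency-sum : ∀ A → A ≡ adjacencyMatrix (CayleySym T) →
    ∀ v i → (A *ᵥ v) i ≃ sum (λ k → v (neighbour k i))
  adjacency-sum A refl v i = ℝ-Ring.trans
    (ℝ-Ring.reflexive (sumᵣ-⊗ (A i) v))
    (sum-over-image {P = Adjacent i} (λ j → dec (flip (decode m j) ∘ₚ decode m i))
      (λ k → neighbour k i) (neighbour-injective i) (λ k → neighbour-adjacent k i)
      (neighbour-onto i) v)

-- The matrix A stands for the adjacency matrix of Cay(S_m, T), which is too costly
-- to unfold.
module Relabelling {m r} (A : Matrix (m !)) (t s : Fin r → Permutation′ m)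
  (neighbour : Fin r → Fin (m !) → Fin (m !))
  (decode-neighbour : ∀ k i x → decode m (neighbour k i) ⟨$⟩ʳ x ≡ t k ⟨$⟩ʳ (decode m i ⟨$⟩ʳ x))
  (adjacency-sum : ∀ v i → (A *ᵥ v) i ≃ sum (λ k → v (neighbour k i)))
  (s-involutive : ∀ k x → s k ⟨$⟩ʳ (s k ⟨$⟩ʳ x) ≡ x)
  (φ : Permutation′ m)
  (φ-t : ∀ k x → φ ⟨$⟩ʳ (t k ⟨$⟩ʳ x) ≡ s k ⟨$⟩ʳ (φ ⟨$⟩ʳ x))
  (t-φ : ∀ k x → t k ⟨$⟩ʳ (φ ⟨$⟩ˡ x) ≡ φ ⟨$⟩ˡ (s k ⟨$⟩ʳ x))
  where

  position : Fin (m !) → Fin m → Fin m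
  position i x = φ ⟨$⟩ʳ (decode m i ⟨$⟩ʳ x)

  position-neighbour : ∀ k i x → position (neighbour k i) x ≡ s k ⟨$⟩ʳ position i x
  position-neighbour k i x = trans (cong (φ ⟨$⟩ʳ_) (decode-neighbour k i x))
    (φ-t k (decode m i ⟨$⟩ʳ x))

  -- The vertex φ⁻¹, at which every point x has position x. An observable takes the value `W x y`
  -- there, which makes the eigenvector nonzero.
  start : Fin (m !)
  start = encode m (flip φ)

  position-start : ∀ x → position start x ≡ x
  position-start x = trans (cong (φ ⟨$⟩ʳ_) (decode-encode m (flip φ) x)) (Perm.inverseʳ φ)

  observable⇒eigenvalue : ∀ μ (W : Fin m → Fin m → ℝ) x y → ¬ (W x y ≃ 0ᵣ) →
    (∀ p q → sum (λ k → W (s k ⟨$⟩ʳ p) (s k ⟨$⟩ʳ q)) ≃ μ ⊗ W p q) → IsEigenvalue A μ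
  observable⇒eigenvalue μ W x y Wxy≄0 eigen = ≃⇒IsEigenvalue A μ v
    (λ v≃0 → Wxy≄0 (subst₂ (λ p q → W p q ≃ 0ᵣ) (position-start x) (position-start y) (v≃0 start)))
    equation
    where
    v : Vector ℝ (m !)
    v i = W (position i x) (position i y)
    equation : ∀ i → (A *ᵥ v) i ≃ μ ⊗ v i
    equation i = ≃-trans {(A *ᵥ v) i} {sum (λ k → v (neighbour k i))} {μ ⊗ v i}
      (adjacency-sum v i)
      (subst (_≃ μ ⊗ v i) (sym (moved i)) (eigen (position i x) (position i y)))
      where
      moved : ∀ i → sum (λ k → v (neighbour k i)) ≡
              sum (λ k → W (s k ⟨$⟩ʳ position i x) (s k ⟨$⟩ʳ position i y))
      moved i = sum-cong-≗ {r} {λ k → v (neighbour k i)}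
        {λ k → W (s k ⟨$⟩ʳ position i x) (s k ⟨$⟩ʳ position i y)}
        (λ k → cong₂ W (position-neighbour k i x) (position-neighbour k i y))

  standard : Fin r → Fin (m !) → Fin (m !)
  standard k j = encode m (decode m j ∘ₚ s k)

  standard-involutive : ∀ k j → standard k (standard k j) ≡ j
  standard-involutive k j = trans
    (encode-cong m (decode m (standard k j) ∘ₚ s k) (decode m j)
      λ x → trans (cong (s k ⟨$⟩ʳ_) (decode-encode m (decode m j ∘ₚ s k) x))
                  (s-involutive k (decode m j ⟨$⟩ʳ x)))
    (encode-decode m j)

  -- Conjugation by φ turns t into s, and right translation moves the vertex i to the
  -- identity, so a single row of the standard matrix has to be computed.
  translate : Fin (m !) → Fin (m !) → Permutation′ m
  translate i j = ((decode m i ∘ₚ φ) ∘ₚ decode m j) ∘ₚ flip φ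

  embed : Fin (m !) → Fin (m !) → Fin (m !)
  embed i j = encode m (translate i j)

  -- With σ the vertex i, π ↦ φ⁻¹πφσ turns left multiplication by s into left multiplication by
  -- φ⁻¹sφ = t. Hence v ∘ `embed i` is an eigenvector for the standard cycle, and its coordinate at
  -- the identity is `v i`.
  embed-standard : ∀ i k j → embed i (standard k j) ≡ neighbour k (embed i j)
  embed-standard i k j = trans
    (encode-cong m (translate i (standard k j)) (decode m (neighbour k (embed i j)))
      λ x → trans
        (cong (φ ⟨$⟩ˡ_) (decode-encode m (decode m j ∘ₚ s k) (position i x)))
        (trans (sym (t-φ k (decode m j ⟨$⟩ʳ position i x)))
          (trans (cong (t k ⟨$⟩ʳ_) (sym (decode-encode m (translate i j) x)))
            (sym (decode-neighbour k (embed i j) x)))))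
    (encode-decode m (neighbour k (embed i j)))

  embed-id : ∀ i → embed i (encode m Perm.id) ≡ i
  embed-id i = trans
    (encode-cong m (translate i (encode m Perm.id)) (decode m i)
      λ x → trans (cong (φ ⟨$⟩ˡ_) (decode-encode m Perm.id (position i x))) (Perm.inverseˡ φ))
    (encode-decode m i)

  open RowReduction standard using (run; basis)

  eigenvector-annihilated : ∀ ks →
    run ks (basis (encode m Perm.id)) ≡ Vec.replicate (m !) 0ℤ →
    ∀ μ v → (∀ i → (A *ᵥ v) i ≈ᵣ μ *ᵣ v i) → ∀ i → factors μ ks (v i) ≃ 0ᵣ
  eigenvector-annihilated ks run≡0 μ v eigen i =
    subst (λ j → factors μ ks (v j) ≃ 0ᵣ) (embed-id i)
      (Rows.annihilated standard standard-involutive (λ j → v (embed i j)) equation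
        ks (encode m Perm.id) run≡0)
    where
    equation : ∀ j → sum (λ k → v (embed i (standard k j))) ≃ μ ⊗ v (embed i j)
    equation j = ≃-trans {sum (λ k → v (embed i (standard k j)))}
      {(A *ᵥ v) (embed i j)} {μ ⊗ v (embed i j)}
      (subst (_≃ (A *ᵥ v) (embed i j)) (sym moved)
        (≃-sym {(A *ᵥ v) (embed i j)} {sum (λ k → v (neighbour k (embed i j)))}
          (adjacency-sum v (embed i j))))
      (eigen⇒≃ A μ v eigen (embed i j))
      where
      moved : sum (λ k → v (embed i (standard k j))) ≡ sum (λ k → v (neighbour k (embed i j)))
      moved = sum-cong-≗ {r} {λ k → v (embed i (standard k j))}
        {λ k → v (neighbour k (embed i j))} (λ k → cong v (embed-standard i k j))

module Cayley {n} (3≤m : 3 ℕ.≤ 3 ℕ.+ n) (T : TranspositionSet (3 ℕ.+ n))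
  (iso : transpositionGraph T ≅ cycleGraph (3 ℕ.+ n) 3≤m) where

  open TranspositionSet T

  m : ℕ
  m = 3 ℕ.+ n

  φ : Permutation′ m
  φ = permutation (Inverse.to (proj₁ iso)) (Inverse.from (proj₁ iso))
    (Inverse.strictlyInverseˡ (proj₁ iso)) (Inverse.strictlyInverseʳ (proj₁ iso))

  t : Fin m → Permutation′ m
  t k = transpose (φ ⟨$⟩ˡ k) (φ ⟨$⟩ˡ next k)

  φ-t : ∀ k x → φ ⟨$⟩ʳ (t k ⟨$⟩ʳ x) ≡ edge k ⟨$⟩ʳ (φ ⟨$⟩ʳ x)
  φ-t k x = transpose-conjugate φ k (next k) x

  t-φ : ∀ k x → t k ⟨$⟩ʳ (φ ⟨$⟩ˡ x) ≡ φ ⟨$⟩ˡ (edge k ⟨$⟩ʳ x)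
  t-φ k x = trans (sym (Perm.inverseˡ φ)) (cong (φ ⟨$⟩ˡ_)
    (trans (φ-t k (φ ⟨$⟩ˡ x)) (cong (edge k ⟨$⟩ʳ_) (Perm.inverseʳ φ))))

  t-member : ∀ k → member (t k)
  t-member k = Equivalence.from (proj₂ iso (φ ⟨$⟩ˡ k) (φ ⟨$⟩ˡ next k)) (inj₁
    (subst₂ Next (sym (Perm.inverseʳ φ)) (sym (Perm.inverseʳ φ)) (Next-next k)))

  t-onto : ∀ π → member π → ∃ λ k → π Perm.≈ t k
  t-onto π Tπ = from-edge (isTransposition Tπ)
    where
    from-edge : IsTransposition π → ∃ λ k → π Perm.≈ t k
    from-edge (i , j , i≢j , π≈ij) =
      from-adjacent (Equivalence.to (proj₂ iso i j) (resp {π} {transpose i j} π≈ij Tπ))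
      where
      back : ∀ a b → Next (φ ⟨$⟩ʳ a) (φ ⟨$⟩ʳ b) → transpose a b Perm.≈ t (φ ⟨$⟩ʳ a)
      back a b a→b x = cong₂ (λ a b → transpose a b ⟨$⟩ʳ x) (sym (Perm.inverseˡ φ))
        (trans (sym (Perm.inverseˡ φ)) (cong (φ ⟨$⟩ˡ_) (Next-unique a→b)))
      from-adjacent : Next (φ ⟨$⟩ʳ i) (φ ⟨$⟩ʳ j) ⊎ Next (φ ⟨$⟩ʳ j) (φ ⟨$⟩ʳ i) →
                      ∃ λ k → π Perm.≈ t k
      from-adjacent (inj₁ i→j) = φ ⟨$⟩ʳ i , λ x → trans (π≈ij x) (back i j i→j x)
      from-adjacent (inj₂ j→i) = φ ⟨$⟩ʳ j , λ x →
        trans (π≈ij x) (trans (transpose-comm i j x) (back j i j→i x))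

  t-injective : ∀ k l → t k Perm.≈ t l → k ≡ l
  t-injective k l k≈l = edge-injective k l λ x → trans
    (sym (moved k x)) (trans (cong (φ ⟨$⟩ʳ_) (k≈l (φ ⟨$⟩ˡ x))) (moved l x))
    where
    moved : ∀ k x → φ ⟨$⟩ʳ (t k ⟨$⟩ʳ (φ ⟨$⟩ˡ x)) ≡ edge k ⟨$⟩ʳ x
    moved k x = trans (φ-t k (φ ⟨$⟩ˡ x)) (cong (edge k ⟨$⟩ʳ_) (Perm.inverseʳ φ))

  t-involutive : ∀ k x → t k ⟨$⟩ʳ (t k ⟨$⟩ʳ x) ≡ x
  t-involutive k = transpose-involutive (φ ⟨$⟩ˡ k) (φ ⟨$⟩ˡ next k)

  edge-involutive : ∀ (k x : Fin m) → edge k ⟨$⟩ʳ (edge k ⟨$⟩ʳ x) ≡ x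
  edge-involutive k = transpose-involutive k (next k)

  open Neighbours T t t-member t-onto t-injective t-involutive

  module _ (A : Matrix (m !)) (A≡ : A ≡ adjacencyMatrix (CayleySym T)) where
    open Relabelling A t edge neighbour decode-neighbour (adjacency-sum A A≡)
      edge-involutive φ φ-t t-φ
      using (observable⇒eigenvalue; eigenvector-annihilated) public

-- The sine eigenvector on the cycle

bounded-below⇒≄0 : ∀ {a} x → 0ℚ ℚ.< a → (∀ n → a ℚ.≤ seq x n) → ¬ (x ≃ 0ᵣ)
bounded-below⇒≄0 {a} x 0<a a≤x ⟪ x≈0 ⟫ =
  let N , close = x≈0 a 0<a
  in <⇒≱ (close N ℕ.≤-refl) (ℚ.≤-trans (a≤x N)
       (ℚ.≤-trans (ℚ.≤-reflexive (sym (ℚ.+-identityʳ (seq x N)))) (p≤∣p∣ (seq x N ℚ.- 0ℚ))))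

-- For x = 2 cos θ this is sin (α + 2θ) + sin (α - 2θ) = 2 cos (2θ) sin α, where 2 cos (2θ) = x² -
-- 2.
four-step : ∀ x k → (Uᵣ x (4 ℕ.+ k) ⊕ Uᵣ x k) ⊕ (Uᵣ x (2 ℕ.+ k) ⊕ Uᵣ x (2 ℕ.+ k)) ≃
            (x ⊗ x) ⊗ Uᵣ x (2 ℕ.+ k)
four-step x k = pointwise λ n → trans
  (trans (seq-⊕ _ _ n) (cong₂ ℚ._+_
    (trans (seq-⊕ _ _ n) (cong₂ ℚ._+_ (seq-U (4 ℕ.+ k) x n) (seq-U k x n)))
    (trans (seq-⊕ _ _ n) (cong₂ ℚ._+_ (seq-U (2 ℕ.+ k) x n) (seq-U (2 ℕ.+ k) x n)))))
  (trans (identity (seq x n) (U (seq x n) (suc k)) (U (seq x n) k))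
    (sym (trans (seq-⊗ _ _ n) (cong₂ ℚ._*_ (seq-⊗ x x n) (seq-U (2 ℕ.+ k) x n)))))
  where
  identity : ∀ x a b → let c = x ℚ.* a ℚ.- b in
    ((x ℚ.* (x ℚ.* c ℚ.- a) ℚ.- c) ℚ.+ b) ℚ.+ (c ℚ.+ c) ≡ (x ℚ.* x) ℚ.* c
  identity = solve 3 (λ x a b → let c = x :* a :- b in
    ((x :* (x :* c :- a) :- c) :+ b) :+ (c :+ c) := (x :* x) :* c) refl

reflect-step : ∀ x a b e f →
  (x ⊗ a ⊝ b) ⊕ f ≃ x ⊗ (a ⊕ e) ⊝ (b ⊕ (x ⊗ e ⊝ f))
reflect-step x a b e f = pointwise λ n → trans
  (trans (seq-⊕ _ f n) (cong (ℚ._+ seq f n)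
    (trans (seq-⊝ _ b n) (cong (ℚ._- seq b n) (seq-⊗ x a n)))))
  (trans (identity (seq x n) (seq a n) (seq b n) (seq e n) (seq f n))
    (sym (trans (seq-⊝ _ _ n) (cong₂ ℚ._-_
      (trans (seq-⊗ x _ n) (cong (seq x n ℚ.*_) (seq-⊕ a e n)))
      (trans (seq-⊕ b _ n) (cong (seq b n ℚ.+_)
        (trans (seq-⊝ _ f n) (cong (ℚ._- seq f n) (seq-⊗ x e n)))))))))
  where
  identity : ∀ x a b e f → (x ℚ.* a ℚ.- b) ℚ.+ f ≡
    x ℚ.* (a ℚ.+ e) ℚ.- (b ℚ.+ (x ℚ.* e ℚ.- f))
  identity = solve 5 (λ x a b e f → (x :* a :- b) :+ f :=
    x :* (a :+ e) :- (b :+ (x :* e :- f))) refl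

-- The sine is odd about its zero at mθ, so the values at m + j and m - j are opposite. The
-- induction on j goes back two steps, running the recurrence upwards at m + j and downwards at m -
-- j.
U-reflect : ∀ {x m} → Uᵣ x m ≃ 0ᵣ → ∀ j k → k ℕ.+ j ≡ m → Uᵣ x (j ℕ.+ m) ⊕ Uᵣ x k ≃ 0ᵣ
U-reflect {x} {m} Um≃0 zero k k≡m = ℝ-Ring.trans
  (ℝ-Ring.+-cong Um≃0 (subst (λ i → Uᵣ x i ≃ 0ᵣ) (trans (sym k≡m) (ℕ.+-identityʳ k)) Um≃0))
  (ℝ-Ring.+-identityˡ 0ᵣ)
U-reflect {x} {m} Um≃0 (suc zero) k k+1≡m = ℝ-Ring.trans
  (reflexive (cong (λ i → Uᵣ x (suc i) ⊕ Uᵣ x k) m≡1+k))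
  (ℝ-Ring.trans (ℝ-Ring.+-assoc (x ⊗ Uᵣ x (suc k)) (⊖ Uᵣ x k) (Uᵣ x k))
    (ℝ-Ring.trans (ℝ-Ring.+-cong
        (ℝ-Ring.trans (ℝ-Ring.*-congˡ (subst (λ i → Uᵣ x i ≃ 0ᵣ) m≡1+k Um≃0)) (ℝ-Ring.zeroʳ x))
        (ℝ-Ring.-‿inverseˡ (Uᵣ x k)))
      (ℝ-Ring.+-identityˡ 0ᵣ)))
  where
  open ℝ-Ring using (reflexive)
  m≡1+k : m ≡ suc k
  m≡1+k = trans (sym k+1≡m) (ℕ.+-comm k 1)
U-reflect {x} {m} Um≃0 (suc (suc j)) k eq = ℝ-Ring.trans
  (reflect-step x (Uᵣ x (suc j ℕ.+ m)) (Uᵣ x (j ℕ.+ m)) (Uᵣ x (suc k)) (Uᵣ x k))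
  (ℝ-Ring.trans
    (ℝ-Ring.+-cong
      (ℝ-Ring.trans (ℝ-Ring.*-congˡ
        (U-reflect Um≃0 (suc j) (suc k) (trans (sym (ℕ.+-suc k (suc j))) eq))) (ℝ-Ring.zeroʳ x))
      (ℝ-Ring.-‿cong (U-reflect Um≃0 j (suc (suc k))
        (trans (cong suc (sym (ℕ.+-suc k j))) (trans (sym (ℕ.+-suc k (suc j))) eq)))))
    (ℝ-Ring.-‿inverseʳ 0ᵣ))

double : ℕ → ℕ
double zero    = zero
double (suc j) = suc (suc (double j))

double≡+ : ∀ j → double j ≡ j ℕ.+ j
double≡+ zero    = refl
double≡+ (suc j) = cong suc (trans (cong suc (double≡+ j)) (sym (ℕ.+-suc j j)))

-- With x = 2 cos (π/m) these are the values of sin (2πp/m) on the m-cycle,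
-- up to a constant factor.
sine : ∀ {m} → ℝ → Fin m → ℝ
sine x p = Uᵣ x (double (toℕ p))

module _ {n} (x : ℝ) (root : Uᵣ x (2 ℕ.+ n) ≃ 0ᵣ) where

  U-double-m : Uᵣ x (double (2 ℕ.+ n)) ≃ 0ᵣ
  U-double-m = ℝ-Ring.trans (ℝ-Ring.reflexive (cong (Uᵣ x) (double≡+ (2 ℕ.+ n))))
    (ℝ-Ring.trans (ℝ-Ring.sym (ℝ-Ring.+-identityʳ _)) (U-reflect root (2 ℕ.+ n) 0 refl))

  sine-next : ∀ (p : Fin (2 ℕ.+ n)) → sine x (next p) ≃ Uᵣ x (double (suc (toℕ p)))
  sine-next p = from-Next (Next-next p)
    where
    from-Next : Next p (next p) → sine x (next p) ≃ Uᵣ x (double (suc (toℕ p)))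
    from-Next (inj₁ eq)       = ℝ-Ring.reflexive (cong (λ i → Uᵣ x (double i)) eq)
    from-Next (inj₂ (eq , z)) = ℝ-Ring.trans
      (ℝ-Ring.reflexive (cong (λ i → Uᵣ x (double i)) z))
      (ℝ-Ring.trans (ℝ-Ring.sym U-double-m)
        (ℝ-Ring.reflexive (cong (λ i → Uᵣ x (double i)) (sym eq))))

  sine-recurrence : ∀ (p : Fin (2 ℕ.+ n)) →
    (sine x (next p) ⊕ sine x (prev p)) ⊕ (sine x p ⊕ sine x p) ≃ (x ⊗ x) ⊗ sine x p
  -- The vertex before 0 is m - 1, with index 2m - 2 = m + n; reflection makes its value opposite to
  -- that at index 2, the successor of 0.
  sine-recurrence zero = ℝ-Ring.trans
    (ℝ-Ring.+-cong
      (ℝ-Ring.trans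
        (ℝ-Ring.+-cong (sine-next zero) (ℝ-Ring.reflexive (cong (Uᵣ x) last-index)))
        (ℝ-Ring.trans (ℝ-Ring.+-comm (Uᵣ x 2) _) (U-reflect root n 2 refl)))
      (ℝ-Ring.+-identityˡ 0ᵣ))
    (ℝ-Ring.trans (ℝ-Ring.+-identityˡ 0ᵣ) (ℝ-Ring.sym (ℝ-Ring.zeroʳ (x ⊗ x))))
    where
    last-index : double (toℕ (fromℕ (suc n))) ≡ n ℕ.+ (2 ℕ.+ n)
    last-index = trans (cong double (Fin.toℕ-fromℕ (suc n)))
      (trans (cong (λ i → suc (suc i)) (double≡+ n))
        (sym (trans (ℕ.+-suc n (suc n)) (cong suc (ℕ.+-suc n n)))))
  sine-recurrence (suc i) = ℝ-Ring.trans
    (ℝ-Ring.+-congʳ (ℝ-Ring.+-cong (sine-next (suc i))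
      (ℝ-Ring.reflexive (cong (λ j → Uᵣ x (double j)) (Fin.toℕ-inject₁ i)))))
    (four-step x (double (toℕ i)))

NonintegralEigenvalue : ∀ {n} → Matrix n → Set
NonintegralEigenvalue A = ∃ λ μ → IsEigenvalue A μ × (∀ z → ¬ (μ ≃ fromℤ z))

-- The permutation representation on the cycle has the eigenvalues
-- m - 2 + 2 cos (2πj/m) = m - 4 + (2 cos (πj/m))².
module _ {n} (interval : RootInterval (3 ℕ.+ n)) where
  open RootInterval interval

  private
    m = 3 ℕ.+ n

  opaque
    cross : Crossing (λ x → U x m) a b
    cross = crossing (λ x → U x m) a b a≤b Ua≤0 0<Ub

  open Crossing cross renaming (lower to x)

  x-root : Uᵣ x m ≃ 0ᵣ
  x-root = CrossingProperties.root cross (λ x → Uᵣ x m) (seq-U m) (Uᵣ-cong m)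

  x² : ℝ
  x² = x ⊗ x

  shift : ℤ
  shift = + m ℤ.- + 4

  x²-bounds : ∀ i → a ℚ.* a ℚ.≤ seq x² i × seq x² i ℚ.≤ b ℚ.* b
  x²-bounds i = subst (λ p → a ℚ.* a ℚ.≤ p × p ℚ.≤ b ℚ.* b) (sym (seq-⊗ x x i))
    ( square-mono-≤ (ℚ.<⇒≤ 0<a) (a≤lower i)
    , square-mono-≤ (ℚ.≤-trans (ℚ.<⇒≤ 0<a) (a≤lower i)) (ℚ.≤-trans (lower≤upper i) (upper≤b i)))

  nonintegral : ∀ y → ¬ (fromℤ shift ⊕ x² ≃ fromℤ y)
  nonintegral y μ≃y = between-integers x² z z<a² b²<z+1 x²-bounds (y ℤ.- shift)
    (ι-difference shift y μ≃y)

  sine-1≄0 : ¬ (sine {m} x 1F ≃ 0ᵣ)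
  sine-1≄0 = bounded-below⇒≄0 (Uᵣ x 2) 0<a λ i →
    ℚ.≤-trans (a≤lower i) (ℚ.≤-reflexive (sym (trans (seq-U 2 x i)
      (trans (ℚ.+-identityʳ _) (ℚ.*-identityʳ (seq x i))))))

  sine-eigen : ∀ (p : Fin m) → sum (λ k → sine x (edge k ⟨$⟩ʳ p)) ≃ (fromℤ shift ⊕ x²) ⊗ sine x p
  sine-eigen = cycle-eigen shift (i-j+j≡i (+ m) (+ 4)) x² (sine x) (sine-recurrence x x-root)

-- The eigenvalue 1 + √5 for the 6-cycle

quadratic : ℚ → ℚ
-- The minimal polynomial x² - 2x - 4 of 1 + √5.
quadratic x = (x ℚ.* x ℚ.- (x ℚ.+ x)) ℚ.- (+ 4 ℚ./ 1)

quadraticᵣ : ℝ → ℝ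
quadraticᵣ x = (x ⊗ x ⊝ (x ⊕ x)) ⊝ fromℤ (+ 4)

seq-quadratic : ∀ x n → seq (quadraticᵣ x) n ≡ quadratic (seq x n)
seq-quadratic x n = trans (seq-⊝ _ _ n) (cong (ℚ._- (+ 4 ℚ./ 1))
  (trans (seq-⊝ _ _ n) (cong₂ ℚ._-_ (seq-⊗ x x n) (seq-⊕ x x n))))

quadraticᵣ-cong : ∀ {x y} → x ≃ y → quadraticᵣ x ≃ quadraticᵣ y
quadraticᵣ-cong x≃y = ℝ-Ring.+-congʳ (ℝ-Ring.+-cong (ℝ-Ring.*-cong x≃y x≃y)
  (ℝ-Ring.-‿cong (ℝ-Ring.+-cong x≃y x≃y)))

-- The coefficients of 1 and μ, where μ = 1 + √5, in the values of the eigenvector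
-- at two vertices of the 6-cycle, depending on their distance.
coefficients : ℕ → ℤ × ℤ
coefficients 0 = + 0 , + 0
coefficients 1 = + 2 , + 0
coefficients 2 = ℤ.- + 4 , + 1
coefficients 3 = + 4 , ℤ.- + 2
coefficients 4 = ℤ.- + 4 , + 1
coefficients _ = + 2 , + 0

α β : Fin 6 → Fin 6 → ℤ
α p q = proj₁ (coefficients ℕ.∣ toℕ p - toℕ q ∣)
β p q = proj₂ (coefficients ℕ.∣ toℕ p - toℕ q ∣)

-- On functions of the cyclic distance 1, 2, 3 of two distinct points, the action has the matrix
-- with rows (4, 2, 0), (2, 2, 2), (0, 4, 2) and characteristic polynomial (x - 6)(x² - 2x - 4). Its
-- eigenvector for μ is (2, μ - 4, 4 - 2μ). Equal points stay equal, so the value 0 at distance 0 is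
-- consistent.
coefficient-sums : ∀ p q →
  ℤ-sum (λ k → α (edge k ⟨$⟩ʳ p) (edge k ⟨$⟩ʳ q)) ≡ β p q ℤ.* + 4 ×
  ℤ-sum (λ k → β (edge k ⟨$⟩ʳ p) (edge k ⟨$⟩ʳ q)) ≡ α p q ℤ.+ β p q ℤ.* + 2
coefficient-sums = toWitness {a? = Fin.all? λ p → Fin.all? λ q →
  (ℤ-sum (λ k → α (edge k ⟨$⟩ʳ p) (edge k ⟨$⟩ʳ q)) ℤ.≟ β p q ℤ.* + 4) ×-dec
  (ℤ-sum (λ k → β (edge k ⟨$⟩ʳ p) (edge k ⟨$⟩ʳ q)) ℤ.≟ α p q ℤ.+ β p q ℤ.* + 2)} tt

-- The endpoints 3.2 and 3.3 enclose 1 + √5 ≈ 3.236 and lie strictly between 3 and 4.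
six-cross : Crossing quadratic (+ 16 ℚ./ 5) (+ 33 ℚ./ 10)
six-cross = crossing quadratic (+ 16 ℚ./ 5) (+ 33 ℚ./ 10)
  (toWitness {a? = (+ 16 ℚ./ 5) ℚ.≤? (+ 33 ℚ./ 10)} tt)
  (toWitness {a? = quadratic (+ 16 ℚ./ 5) ℚ.≤? 0ℚ} tt)
  (toWitness {a? = 0ℚ ℚ.<? quadratic (+ 33 ℚ./ 10)} tt)

opaque
  six-root : ∃ λ μ → μ ⊗ μ ≃ fromℤ (+ 4) ⊕ fromℤ (+ 2) ⊗ μ × (∀ z → ¬ (μ ≃ fromℤ z))
  six-root = lower
    , quadratic-root (CrossingProperties.root six-cross quadraticᵣ seq-quadratic quadraticᵣ-cong)
    , between-integers lower (+ 3)
        (toWitness {a? = (+ 3 ℚ./ 1) ℚ.<? (+ 16 ℚ./ 5)} tt)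
        (toWitness {a? = (+ 33 ℚ./ 10) ℚ.<? (+ 4 ℚ./ 1)} tt)
        (λ n → a≤lower n , ℚ.≤-trans (lower≤upper n) (upper≤b n))
    where open Crossing six-cross

module _ (μ : ℝ) where
  six-observable : Fin 6 → Fin 6 → ℝ
  six-observable p q = fromℤ (α p q) ⊕ fromℤ (β p q) ⊗ μ

  six-nonzero : ¬ (six-observable 0F 1F ≃ 0ᵣ)
  six-nonzero = bounded-below⇒≄0 (six-observable 0F 1F)
    (toWitness {a? = 0ℚ ℚ.<? (+ 2 ℚ./ 1)} tt)
    λ n → ℚ.≤-reflexive (sym (trans (seq-⊕ (fromℤ (+ 2)) (fromℤ (+ 0) ⊗ μ) n)
      (trans (cong (λ p → (+ 2 ℚ./ 1) ℚ.+ p) (trans (seq-⊗ (fromℤ (+ 0)) μ n) (ℚ.*-zeroˡ (seq μ n))))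
        (ℚ.+-identityʳ (+ 2 ℚ./ 1)))))

  six-eigen : μ ⊗ μ ≃ fromℤ (+ 4) ⊕ fromℤ (+ 2) ⊗ μ →
    ∀ p q → sum (λ k → six-observable (edge k ⟨$⟩ʳ p) (edge k ⟨$⟩ʳ q)) ≃ μ ⊗ six-observable p q
  six-eigen μ² p q = quadratic-eigen μ²
    (λ k → α (edge k ⟨$⟩ʳ p) (edge k ⟨$⟩ʳ q)) (λ k → β (edge k ⟨$⟩ʳ p) (edge k ⟨$⟩ʳ q))
    (α p q) (β p q) (proj₁ (coefficient-sums p q)) (proj₂ (coefficient-sums p q))

-- The integral cases m = 3 and m = 4

spectrum₃ spectrum₄ : List ℤ
-- All three transpositions occur, so the Cayley graph is the complete bipartite graph K₃,₃.
spectrum₃ = + 0 ∷ + 3 ∷ ℤ.- + 3 ∷ []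
-- The trivial and sign representations give ±4, the standard one 0 and 2, its product with the sign
-- 0 and -2, the two-dimensional one ±2. The matrix is symmetric, so one factor per eigenvalue
-- suffices.
spectrum₄ = + 0 ∷ + 2 ∷ ℤ.- + 2 ∷ + 4 ∷ ℤ.- + 4 ∷ []

separated? : ∀ k l → Dec (Separated k l)
separated? k l = 1ℚ ℚ.≤? ∣ k ℚ./ 1 ℚ.- l ℚ./ 1 ∣

separated₃ : AllPairs Separated spectrum₃
separated₃ = toWitness {a? = allPairs? separated? spectrum₃} tt

separated₄ : AllPairs Separated spectrum₄
separated₄ = toWitness {a? = allPairs? separated? spectrum₄} tt

module _ {n} (3≤m : 3 ≤ 3 ℕ.+ n) (T : TranspositionSet (3 ℕ.+ n))
  (iso : transpositionGraph T ≅ cycleGraph (3 ℕ.+ n) 3≤m) where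
  open Cayley 3≤m T iso using (observable⇒eigenvalue; eigenvector-annihilated)

  module _ (A : Matrix ((3 ℕ.+ n) !)) (A≡ : A ≡ adjacencyMatrix (CayleySym T)) where

    interval⇒nonintegral : RootInterval (3 ℕ.+ n) → NonintegralEigenvalue A
    interval⇒nonintegral interval = fromℤ (shift interval) ⊕ x² interval
      , observable⇒eigenvalue A A≡ (fromℤ (shift interval) ⊕ x² interval)
          (λ p _ → sine (Crossing.lower (cross interval)) p) 1F 1F (sine-1≄0 interval)
          (λ p _ → sine-eigen interval p)
      , nonintegral interval

    annihilated⇒integral : ∀ ks → AllPairs Separated ks →
      (∀ μ v → (∀ i → (A *ᵥ v) i ≈ᵣ μ *ᵣ v i) → ∀ i → factors μ ks (v i) ≃ 0ᵣ) →
      ∀ μ → IsEigenvalue A μ → ∃ λ z → μ ≈ᵣ fromℤ z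
    annihilated⇒integral ks separated annihilate μ (v , v≄0 , eigen) =
      let z , μ≃z = root-of-factors μ ks v separated
                      (λ v≃0 → v≄0 λ i → limit (v≃0 i)) (annihilate μ v eigen)
      in z , limit μ≃z

nonintegral-6 : (3≤6 : 3 ≤ 6) (T : TranspositionSet 6) →
  transpositionGraph T ≅ cycleGraph 6 3≤6 →
  ∀ A → A ≡ adjacencyMatrix (CayleySym T) → NonintegralEigenvalue A
nonintegral-6 3≤6 T iso A A≡ = let μ , μ² , nonintegral = six-root in
  μ , Cayley.observable⇒eigenvalue 3≤6 T iso A A≡ μ (six-observable μ) 0F 1F (six-nonzero μ)
        (six-eigen μ μ²)
    , nonintegral

nonintegral-5+ : ∀ n (3≤m : 3 ≤ 5 ℕ.+ n) (T : TranspositionSet (5 ℕ.+ n)) →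
  transpositionGraph T ≅ cycleGraph (5 ℕ.+ n) 3≤m →
  ∀ A → A ≡ adjacencyMatrix (CayleySym T) → NonintegralEigenvalue A
nonintegral-5+ 0 3≤m T iso A A≡ = interval⇒nonintegral 3≤m T iso A A≡ root-interval-5
nonintegral-5+ 1 3≤m T iso A A≡ = nonintegral-6 3≤m T iso A A≡
nonintegral-5+ (suc (suc n)) 3≤m T iso A A≡ =
  interval⇒nonintegral 3≤m T iso A A≡ (root-interval-7+ n)

integral-3 : (3≤3 : 3 ≤ 3) (T : TranspositionSet 3) →
  transpositionGraph T ≅ cycleGraph 3 3≤3 →
  ∀ A → A ≡ adjacencyMatrix (CayleySym T) → ∀ μ → IsEigenvalue A μ → ∃ λ z → μ ≈ᵣ fromℤ z
integral-3 3≤3 T iso A A≡ = annihilated⇒integral 3≤3 T iso A A≡ spectrum₃ separated₃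
  (Cayley.eigenvector-annihilated 3≤3 T iso A A≡ spectrum₃ refl)

integral-4 : (3≤4 : 3 ≤ 4) (T : TranspositionSet 4) →
  transpositionGraph T ≅ cycleGraph 4 3≤4 →
  ∀ A → A ≡ adjacencyMatrix (CayleySym T) → ∀ μ → IsEigenvalue A μ → ∃ λ z → μ ≈ᵣ fromℤ z
integral-4 3≤4 T iso A A≡ = annihilated⇒integral 3≤4 T iso A A≡ spectrum₄ separated₄
  -- `refl` evaluates the row of the identity, 24 integers, through the five factors.
  (Cayley.eigenvector-annihilated 3≤4 T iso A A≡ spectrum₄ refl)

nonintegral⇒¬Integral : ∀ G →
  (∀ A → A ≡ adjacencyMatrix G → NonintegralEigenvalue A) → ¬ Integral G
nonintegral⇒¬Integral G eigenvalue integral =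
  let μ , eigen , nonintegral = eigenvalue (adjacencyMatrix G) refl
      z , μ≈z = integral μ eigen
  in nonintegral z ⟪ μ≈z ⟫

integers⇒Integral : ∀ G → (∀ A → A ≡ adjacencyMatrix G →
  ∀ μ → IsEigenvalue A μ → ∃ λ z → μ ≈ᵣ fromℤ z) → Integral G
integers⇒Integral G integers = integers (adjacencyMatrix G) refl

proposition4 : (m : ℕ) (3≤m : 3 ≤ m) (T : TranspositionSet m) →
    transpositionGraph T ≅ cycleGraph m 3≤m →
    Integral (CayleySym T) ⇔ (m ≡ 3 ⊎ m ≡ 4)
proposition4 m 3≤m T iso = mk⇔ (forward m 3≤m T iso) (backward m 3≤m T iso)
  where
  forward : ∀ m (3≤m : 3 ≤ m) (T : TranspositionSet m) →
    transpositionGraph T ≅ cycleGraph m 3≤m → Integral (CayleySym T) → m ≡ 3 ⊎ m ≡ 4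
  forward 3 _ _ _ _ = inj₁ refl
  forward 4 _ _ _ _ = inj₂ refl
  forward (suc (suc (suc (suc (suc n))))) 3≤m T iso integral = contradiction integral
    (nonintegral⇒¬Integral (CayleySym T) (nonintegral-5+ n 3≤m T iso))
  forward 2 (s≤s (s≤s ()))
  forward 1 (s≤s ())
  forward 0 ()
  backward : ∀ m (3≤m : 3 ≤ m) (T : TranspositionSet m) →
    transpositionGraph T ≅ cycleGraph m 3≤m → m ≡ 3 ⊎ m ≡ 4 → Integral (CayleySym T)
  backward 3 3≤m T iso (inj₁ refl) = integers⇒Integral (CayleySym T) (integral-3 3≤m T iso)
  backward 4 3≤m T iso (inj₂ refl) = integers⇒Integral (CayleySym T) (integral-4 3≤m T iso)
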